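{- Let $t$ be a $\mathsf{PCF}$ program such that $t\Downarrow^{n}\underline m$. Then there exist two index terms $I$ and $J$ such that $[\![I]\!]^{\mathcal U}\le n$ and $[\![J]\!]^{\mathcal U}=m$, and such that $t$ is typable in $\mathsf{d}\ell\mathsf{PCF}$ as $\vdash^{\mathcal U}_I t:\mathsf{Nat}[J]$ (i.e. $\emptyset;\emptyset;\emptyset\vdash^{\mathcal U}_I t:\mathsf{Nat}[J,J]$).
   Context: **Index terms.** A signature is a finite set of function symbols with arities, always containing $\mathbf 0,\mathbf 1$ (arity $0$) and $+,\dot-$ (arity $2$). Index terms: $I,J,K::=a\mid \mathtt f(I_1,\dots,I_k)\mid \sum_{a<I}J\mid\bigtriangleup_a^{I,J}K$, with $a$ an index variable (bound in $J$, resp. in $K$); $\mathbf n$ is $\mathbf 1+\dots+\mathbf 1$ ($n$ times); $X\{I/a\}$ is capture-avoiding substitution of $I$ for $a$. An equational program $\mathcal E$ is a set of equations between first-order terms over the signature, assumed to determine uniquely each function symbol as a partial function on $\mathbb N$ ($\mathbf 0,\mathbf 1,+$ standard, $\dot-$ truncated subtraction). For an assignment $\rho$ of naturals to index variables, $[\![I]\!]^{\mathcal E}_\rho$ (possibly undefined) is the value of $I$: $\sum_{a<I}J$ is the sum of the values of $J$ for $a=0,\dots,I-1$; the forest cardinality satisfies $\bigtriangleup_a^{I,\mathbf 0}K=\mathbf 0$ and $\bigtriangleup_a^{I,J+\mathbf 1}K=F+\mathbf 1+\bigtriangleup_a^{I+\mathbf 1+F,\;K\{I+F/a\}}K$ with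 $F=\bigtriangleup_a^{I,J}K$, and is undefined when the unfolding does not terminate (it counts the nodes of a forest of $J$ trees numbered in pre-order starting from $I$, node $k$ having $K\{\mathbf k/a\}$ children). A constraint is $I\le J$ ($I<J$ means $I+\mathbf 1\le J$); it is true in $\rho$ if both sides are defined and the inequality holds. For a set $\phi$ of index variables and a set $\Phi$ of constraints over $\phi$, $\phi;\Phi\models I\le J$ means every assignment making all of $\Phi$ true makes $I\le J$ true; similarly for $=,\ge$. $\phi;\Phi\models I\Downarrow$ means $\phi;\Phi\models I\ge\mathbf 0$ (definedness). **Universal program.** Equational programs (e.g. Herbrand–Gödel schemes) and function symbols in them are effectively coded by natural numbers $\ulcorner\mathcal E,\mathtt f\urcorner$. $\mathcal U$ is a fixed universal equational program: a finite program over a signature $\Sigma_{\mathcal U}$ containing $\mathtt{empty}$ (arity $0$), $\mathtt{pair},\mathtt{eval}$ (arity $2$) and auxiliary symbols, able to simulate every equational program: $[\![\mathtt{eval}(\ulcorner\mathcal E,\mathtt f\urcorner,\mathit{pairing}_n(x_1,\dots,x_n))]\!]^{\mathcal U}_\rho=[\![\mathtt f(x_1,\dots,x_n)]\!]^{\mathcal E}_\rho$ for every $\mathtt f$ of arity $n$ in $\mathcal E$, where $\mathit{pairing}_0=\mathtt{empty}$, $\mathit{pairing}_{n+1}(t_1,\dots,t_{n+1})=\mathtt{pair}(\mathit{pairing}_n(t_1,\dots,t_n),t_{n+1})$. In particular all total computable functions are expressible by index terms over $\Sigma_{\mathcal U}$. **Types.** Basic types $\sigma,\tau::=\mathsf{Nat}[I,J]\mid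 A\multimap\sigma$; modal types $A,B::=[a<I]\cdot\sigma$ ($a$ bound in $\sigma$); $\mathsf{Nat}[I]=\mathsf{Nat}[I,I]$. Subtyping $\phi;\Phi\vdash\cdot\sqsubseteq\cdot$: $\mathsf{Nat}[I,J]\sqsubseteq\mathsf{Nat}[K,H]$ if $\phi;\Phi\models K\le I$ and $\phi;\Phi\models J\le H$; $A\multimap\sigma\sqsubseteq B\multimap\tau$ if $B\sqsubseteq A$ and $\sigma\sqsubseteq\tau$; $[a<I]\cdot\sigma\sqsubseteq[a<J]\cdot\tau$ if $\phi,a;\Phi,a<I\vdash\sigma\sqsubseteq\tau$ and $\phi;\Phi\models J\le I$. A type is well defined, $\phi;\Phi\vdash\sigma\Downarrow$, if it is a subtype of itself. Sums: if $A=[a<I]\cdot\mu\{a/c\}$ and $B=[b<J]\cdot\mu\{I+b/c\}$ then $A\uplus B=[c<I+J]\cdot\mu$; if $A=[b<J]\cdot\sigma\{\sum_{d<a}J\{d/a\}+b/c\}$ then $\sum_{a<I}A=[c<\sum_{a<I}J]\cdot\sigma$. Typing contexts assign modal types to distinct term variables; $\uplus,\sum,\sqsubseteq,\Downarrow$ extend to contexts pointwise. All index terms in types are assumed defined for the relevant values of variables. **Terms and PCF.** $t::=x\mid\underline n\mid\mathtt s(t)\mid\mathtt p(t)\mid\lambda x.t\mid tu\mid\mathtt{ifz}\ t\ \mathtt{then}\ u\ \mathtt{else}\ v\mid\mathtt{fix}\ x.t$. $\mathsf{PCF}$ types are built from $\mathsf{Nat}$ and $\to$, with the usual simply-typed rules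 for variables, abstraction, application; $\underline n:\mathsf{Nat}$; $\mathtt s(t),\mathtt p(t):\mathsf{Nat}$ if $t:\mathsf{Nat}$; $\mathtt{ifz}\ t\ \mathtt{then}\ u\ \mathtt{else}\ v:\sigma$ if $t:\mathsf{Nat}$, $u,v:\sigma$; $\Gamma\vdash\mathtt{fix}\,x.t:\sigma$ if $\Gamma,x:\sigma\vdash t:\sigma$. A program is a term $t$ with $\vdash t:\mathsf{Nat}$ in the empty context. **Typing rules of $\mathsf{d}\ell\mathsf{PCF}$** (judgements $\phi;\Phi;\Gamma\vdash^{\mathcal E}_I t:\sigma$, weight $I$, semantic premises taken w.r.t. $\mathcal E$; below $\models,\vdash$ without left-hand side are under $\phi;\Phi$): (V) $\phi;\Phi;\Gamma,x:[a<I]\cdot\sigma\vdash_J x:\tau$ if $\models\mathbf 0\le J$, $\models\mathbf 1\le I$, $\vdash\sigma\{\mathbf 0/a\}\sqsubseteq\tau$, and $[a<I]\cdot\sigma$ and $\Gamma$ are well defined. (L) from $\phi;\Phi;\Gamma,x:[a<I]\cdot\sigma\vdash_J t:\tau$ infer $\phi;\Phi;\Gamma\vdash_J\lambda x.t:[a<I]\cdot\sigma\multimap\tau$. (A) from $\phi;\Phi;\Gamma\vdash_J t:[a<I]\cdot\sigma\multimap\tau$, $\phi,a;\Phi,a<I;\Delta\vdash_K u:\sigma$, $\vdash\Sigma\sqsubseteq\Gamma\uplus\sum_{a<I}\Delta$, $\models H\ge J+I+\sum_{a<I}K$ infer $\phi;\Phi;\Sigma\vdash_H tu:\tau$. (N)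 $\phi;\Phi;\Gamma\vdash_K\underline n:\mathsf{Nat}[I,J]$ if $\models K\ge\mathbf 0$, $\models I\le\mathbf n$, $\models\mathbf n\le J$, $\Gamma$ well defined. (S) from $\phi;\Phi;\Gamma\vdash_L t:\mathsf{Nat}[I,J]$ and $\vdash\mathsf{Nat}[I+\mathbf 1,J+\mathbf 1]\sqsubseteq\mathsf{Nat}[K,H]$ infer $\phi;\Phi;\Gamma\vdash_L\mathtt s(t):\mathsf{Nat}[K,H]$. (P) the same with $\mathtt p$ and $\dot-\mathbf 1$ instead of $\mathtt s$ and $+\mathbf 1$. (F) from $\phi;\Phi;\Gamma\vdash_K t:\mathsf{Nat}[I,J]$, $\phi;\Phi,I\le\mathbf 0;\Delta\vdash_H u:\sigma$, $\phi;\Phi,J\ge\mathbf 1;\Delta\vdash_H v:\sigma$, $\vdash\Sigma\sqsubseteq\Gamma\uplus\Delta$, $\models L\ge K+H$ infer $\phi;\Phi;\Sigma\vdash_L\mathtt{ifz}\ t\ \mathtt{then}\ u\ \mathtt{else}\ v:\sigma$. (R) from $\phi,b;\Phi,b<L;\Gamma,x:[a<I]\cdot\sigma\vdash_K t:\tau$, $\vdash\tau\{\mathbf 0/b\}\sqsubseteq\mu$, $\phi,a,b;\Phi,a<I,b<L\vdash\tau\{\bigtriangleup_b^{b+\mathbf 1,a}I+b+\mathbf 1/b\}\sqsubseteq\sigma$, $\vdash\Sigma\sqsubseteq\sum_{b<L}\Gamma$, $\models\bigtriangleup_b^{\mathbf 0,\mathbf 1}I\le L$, $\models\bigtriangleup_b^{\mathbf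 0,\mathbf 1}I\le M$, $\models N\ge(M\dot-\mathbf 1)+\sum_{b<L}K$ infer $\phi;\Phi;\Sigma\vdash_N\mathtt{fix}\ x.t:\mu$. **Machine.** Configurations are triples $(t,\rho,\xi)$: a term, an environment (finite sequence of closures), a stack (finite sequence of contexts). A closure is a pair (term, environment); a context is a closure, the symbol $\mathtt s$, the symbol $\mathtt p$, or a triple $(u,v,\rho)$ of two terms and an environment. Variable names are handled naively: each closure in an environment is attached to the variable for which it was pushed, and $(t_x,\rho_x)$ is the closure attached to $x$. Transitions: $(tu,\rho,\xi)\to(t,\rho,(u,\rho)\cdot\xi)$; $(\lambda x.t,\rho,c\cdot\xi)\to(t,c\cdot\rho,\xi)$; $(x,\rho,\xi)\to(t_x,\rho_x,\xi)$; $(\mathtt{ifz}\ t\ \mathtt{then}\ u\ \mathtt{else}\ v,\rho,\xi)\to(t,\rho,(u,v,\rho)\cdot\xi)$; $(\mathtt{fix}\,x.t,\rho,\xi)\to(t,(\mathtt{fix}\,x.t,\rho)\cdot\rho,\xi)$; $(\underline n,\rho,\mathtt s\cdot\xi)\to(\underline{n+1},\rho,\xi)$; $(\underline n,\rho,\mathtt p\cdot\xi)\to(\underline{n\dot-1},\rho,\xi)$; $(\underline 0,\rho,(t,u,\mu)\cdot\xi)\to(t,\mu,\xi)$; $(\underline{n+1},\rho,(t,u,\mu)\cdot\xi)\to(u,\mu,\xi)$; $(\mathtt s(t),\rho,\xi)\to(t,\rho,\mathtt s\cdot\xi)$; $(\mathtt p(t),\rho,\xi)\to(t,\rho,\mathtt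 p\cdot\xi)$. With $\varepsilon$ the empty sequence, $t\Downarrow^n\underline m$ means $(t,\varepsilon,\varepsilon)$ reaches $(\underline m,\rho,\varepsilon)$, for some $\rho$, in exactly $n$ transitions. -}

module Defs where

open import Data.Fin.Base using (Fin; zero; suc; lift)
open import Data.List.Base using (List; []; _∷_; map)
open import Data.List.Membership.Propositional using (_∈_)
open import Data.List.Relation.Unary.All using (All)
open import Data.Maybe.Base using (Maybe; just)
open import Data.Nat.Base using (ℕ; zero; suc; _+_; _∸_; _≤_)
open import Data.Product.Base using (∃; ∃₂; _×_; _,_)
open import Data.Vec.Base using (Vec; []; _∷_; lookup; tabulate; foldl′)
open import Data.Vec.Functional using () renaming (_∷_ to _•_)
open import Data.Vec.Relation.Binary.Pointwise.Inductive using (Pointwise)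
open import Function.Base using (_∘_)
open import Function.Bundles using (_⇔_)
open import Relation.Binary.PropositionalEquality using (_≡_)

------------------------------------------------------------------------
-- Equational programs

-- Only the symbols other than 𝟎, 𝟏, + and ∸ are listed.
record Signature : Set where
  field
    size  : ℕ
    arity : Vec ℕ size

open Signature public

data Symbol (S : Signature) : ℕ → Set where
  `0 `1 : Symbol S 0
  `+ `∸ : Symbol S 2
  `_    : (i : Fin (size S)) → Symbol S (lookup (arity S) i)

data FOTerm (S : Signature) (n : ℕ) : Set where
  var : Fin n → FOTerm S n
  _$_ : ∀ {k} → Symbol S k → Vec (FOTerm S n) k → FOTerm S n

record Equation (S : Signature) : Set where
  constructor _≐_
  field
    {vars}  : ℕ
    lhs rhs : FOTerm S vars

record Program : Set where
  field
    sig       : Signature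
    equations : List (Equation sig)

open Program public

-- Herbrand-Gödel semantics.  E ⊢ f · vs ↦ v holds when the equation
-- f(vs) = v between numerals is derivable from E by instantiating variables
-- with numerals and replacing closed subterms by their already derived
-- values; 𝟎, 𝟏, + and ∸ are given their standard graphs.
mutual
  data _⊢_·_↦_ (E : Program) : ∀ {k} → Symbol (sig E) k → Vec ℕ k → ℕ → Set where
    zero  : E ⊢ `0 · [] ↦ 0
    one   : E ⊢ `1 · [] ↦ 1
    plus  : ∀ x y → E ⊢ `+ · (x ∷ y ∷ []) ↦ (x + y)
    monus : ∀ x y → E ⊢ `∸ · (x ∷ y ∷ []) ↦ (x ∸ y)
    rule  : ∀ {n k v} {f : Symbol (sig E) k} {ts : Vec (FOTerm (sig E) n) k}
              {r : FOTerm (sig E) n} {vs : Vec ℕ k} (ρ : Vec ℕ n) →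
            ((f $ ts) ≐ r) ∈ equations E →
            Pointwise (Eval E ρ) ts vs →
            Eval E ρ r v →
            E ⊢ f · vs ↦ v

  data Eval (E : Program) {n} (ρ : Vec ℕ n) : FOTerm (sig E) n → ℕ → Set where
    var : ∀ i → Eval E ρ (var i) (lookup ρ i)
    app : ∀ {k v} {f : Symbol (sig E) k} {ts vs} →
          Pointwise (Eval E ρ) ts vs →
          E ⊢ f · vs ↦ v →
          Eval E ρ (f $ ts) v

-- E determines each symbol as a partial function, and its equations hold
-- wherever both sides are defined.
record Determined (E : Program) : Set where
  field
    functional : ∀ {k} (f : Symbol (sig E) k) {vs v w} →
                 E ⊢ f · vs ↦ v → E ⊢ f · vs ↦ w → v ≡ w
    consistent : ∀ {e} → e ∈ equations E → ∀ ρ {v w} →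
                 Eval E ρ (Equation.lhs e) v → Eval E ρ (Equation.rhs e) w → v ≡ w

------------------------------------------------------------------------
-- Index terms

-- Index S φ: index terms whose free variables are de Bruijn indices below φ.
-- ∑ I J is ∑_{a<I} J and △ I J K is △_a^{I,J} K, with a the variable zero of
-- J, respectively of K.
data Index (S : Signature) (φ : ℕ) : Set where
  var : Fin φ → Index S φ
  _$_ : ∀ {k} → Symbol S k → Vec (Index S φ) k → Index S φ
  ∑   : Index S φ → Index S (suc φ) → Index S φ
  △   : Index S φ → Index S φ → Index S (suc φ) → Index S φ

module _ {S : Signature} {φ : ℕ} where

  infixl 6 _+ᵢ_ _∸ᵢ_

  𝟎 𝟏 : Index S φ
  𝟎 = `0 $ []
  𝟏 = `1 $ []

  _+ᵢ_ _∸ᵢ_ : Index S φ → Index S φ → Index S φ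
  I +ᵢ J = `+ $ (I ∷ J ∷ [])
  I ∸ᵢ J = `∸ $ (I ∷ J ∷ [])

  num : ℕ → Index S φ
  num zero          = 𝟎
  num (suc zero)    = 𝟏
  num (suc (suc n)) = num (suc n) +ᵢ 𝟏

mutual
  ren : ∀ {S φ ψ} → (Fin φ → Fin ψ) → Index S φ → Index S ψ
  ren θ (var i)   = var (θ i)
  ren θ (f $ Is)  = f $ renVec θ Is
  ren θ (∑ I J)   = ∑ (ren θ I) (ren (lift 1 θ) J)
  ren θ (△ I J K) = △ (ren θ I) (ren θ J) (ren (lift 1 θ) K)

  renVec : ∀ {S φ ψ k} → (Fin φ → Fin ψ) → Vec (Index S φ) k → Vec (Index S ψ) k
  renVec θ []       = []
  renVec θ (I ∷ Is) = ren θ I ∷ renVec θ Is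

wk : ∀ {S φ} → Index S φ → Index S (suc φ)
wk = ren suc

Subst : Signature → ℕ → ℕ → Set
Subst S φ ψ = Fin φ → Index S ψ

exts : ∀ {S φ ψ} → Subst S φ ψ → Subst S (suc φ) (suc ψ)
exts θ = var zero • (wk ∘ θ)

mutual
  sub : ∀ {S φ ψ} → Subst S φ ψ → Index S φ → Index S ψ
  sub θ (var i)   = θ i
  sub θ (f $ Is)  = f $ subVec θ Is
  sub θ (∑ I J)   = ∑ (sub θ I) (sub (exts θ) J)
  sub θ (△ I J K) = △ (sub θ I) (sub θ J) (sub (exts θ) K)

  subVec : ∀ {S φ ψ k} → Subst S φ ψ → Vec (Index S φ) k → Vec (Index S ψ) k
  subVec θ []       = []
  subVec θ (I ∷ Is) = sub θ I ∷ subVec θ Is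

-- E ∣ ρ ⊢ I ⇓ v: the value of I under E and the assignment ρ is v; I is
-- undefined in ρ when there is no such v.  Function symbols, ∑ and △ are
-- strict in all the values they depend on.
mutual
  data _∣_⊢_⇓_ (E : Program) {φ} (ρ : Vec ℕ φ) : Index (sig E) φ → ℕ → Set where
    var : ∀ i → E ∣ ρ ⊢ var i ⇓ lookup ρ i
    app : ∀ {k v} {f : Symbol (sig E) k} {Is vs} →
          Pointwise (λ I w → E ∣ ρ ⊢ I ⇓ w) Is vs →
          E ⊢ f · vs ↦ v →
          E ∣ ρ ⊢ f $ Is ⇓ v
    sum : ∀ {I J n v} →
          E ∣ ρ ⊢ I ⇓ n →
          Sum E ρ J n v →
          E ∣ ρ ⊢ ∑ I J ⇓ v
    forest : ∀ {I J K i j v} →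
             E ∣ ρ ⊢ I ⇓ i →
             E ∣ ρ ⊢ J ⇓ j →
             Forest E ρ K i j v →
             E ∣ ρ ⊢ △ I J K ⇓ v

  data Sum (E : Program) {φ} (ρ : Vec ℕ φ) (J : Index (sig E) (suc φ)) :
           ℕ → ℕ → Set where
    zero : Sum E ρ J 0 0
    suc  : ∀ {n v w} →
           Sum E ρ J n v →
           E ∣ n ∷ ρ ⊢ J ⇓ w →
           Sum E ρ J (suc n) (v + w)

  data Forest (E : Program) {φ} (ρ : Vec ℕ φ) (K : Index (sig E) (suc φ)) :
              ℕ → ℕ → ℕ → Set where
    zero : ∀ {i} → Forest E ρ K i 0 0
    suc  : ∀ {i j k F G} →
           Forest E ρ K i j F →
           E ∣ (i + F) ∷ ρ ⊢ K ⇓ k →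
           Forest E ρ K (i + 1 + F) k G →
           Forest E ρ K i (suc j) (F + 1 + G)

------------------------------------------------------------------------
-- Constraints

infix 4 _≼_ _≺_ _≽_

data Constraint (S : Signature) (φ : ℕ) : Set where
  _≼_ : Index S φ → Index S φ → Constraint S φ

_≺_ _≽_ : ∀ {S φ} → Index S φ → Index S φ → Constraint S φ
I ≺ J = (I +ᵢ 𝟏) ≼ J
I ≽ J = J ≼ I

wkᶜ : ∀ {S φ} → Constraint S φ → Constraint S (suc φ)
wkᶜ (I ≼ J) = wk I ≼ wk J

True : (E : Program) → ∀ {φ} → Vec ℕ φ → Constraint (sig E) φ → Set
True E ρ (I ≼ J) = ∃₂ λ v w → (E ∣ ρ ⊢ I ⇓ v) × (E ∣ ρ ⊢ J ⇓ w) × v ≤ w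

Constraints : Signature → ℕ → Set
Constraints S φ = List (Constraint S φ)

-- Φ ,< I extends Φ with a < I for a fresh index variable a.
_,<_ : ∀ {S φ} → Constraints S φ → Index S φ → Constraints S (suc φ)
Φ ,< I = (var zero ≺ wk I) ∷ map wkᶜ Φ

infix 3 _∣_⊨_

_∣_⊨_ : (E : Program) → ∀ {φ} → Constraints (sig E) φ → Constraint (sig E) φ → Set
E ∣ Φ ⊨ C = ∀ ρ → All (True E ρ) Φ → True E ρ C

------------------------------------------------------------------------
-- Universal programs

-- pairing (t₁, …, tₙ) = pair (… pair (pair (empty, t₁), t₂) …, tₙ)
pairing : ∀ {S φ n} → Symbol S 0 → Symbol S 2 → Vec (Index S φ) n → Index S φ
pairing empty pair = foldl′ (λ t u → pair $ (t ∷ u ∷ [])) (empty $ [])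

-- The coding is arbitrary as long as it can be decoded.  Both sides of
-- simulates are evaluated with the n index variables as arguments, and have
-- the same value or are both undefined.
record Universal (U : Program) : Set where
  field
    determined  : Determined U
    empty       : Symbol (sig U) 0
    pair eval   : Symbol (sig U) 2
    code        : (E : Program) → ∀ {k} → Symbol (sig E) k → ℕ
    decode      : ℕ → Maybe (∃₂ λ E k → Symbol (sig E) k)
    decode-code : ∀ E {k} (f : Symbol (sig E) k) → decode (code E f) ≡ just (E , k , f)
    simulates   :
      ∀ E → Determined E → ∀ {n} (f : Symbol (sig E) n) (ρ : Vec ℕ n) v →
      (U ∣ ρ ⊢ eval $ (num (code E f) ∷ pairing empty pair (tabulate var) ∷ []) ⇓ v)
        ⇔ (E ∣ ρ ⊢ f $ tabulate var ⇓ v)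

------------------------------------------------------------------------
-- Types

infixr 7 _⊸_
infix  8 [<_]·_

-- The index variable bound by [<_]·_ is the variable zero of its body.
mutual
  data Basic (S : Signature) (φ : ℕ) : Set where
    Nat[_⋯_] : Index S φ → Index S φ → Basic S φ
    _⊸_      : Modal S φ → Basic S φ → Basic S φ

  data Modal (S : Signature) (φ : ℕ) : Set where
    [<_]·_ : Index S φ → Basic S (suc φ) → Modal S φ

Nat[_] : ∀ {S φ} → Index S φ → Basic S φ
Nat[ I ] = Nat[ I ⋯ I ]

mutual
  subᵇ : ∀ {S φ ψ} → Subst S φ ψ → Basic S φ → Basic S ψ
  subᵇ θ Nat[ I ⋯ J ] = Nat[ sub θ I ⋯ sub θ J ]
  subᵇ θ (A ⊸ σ)      = subᵐ θ A ⊸ subᵇ θ σ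

  subᵐ : ∀ {S φ ψ} → Subst S φ ψ → Modal S φ → Modal S ψ
  subᵐ θ ([< I ]· σ) = [< sub θ I ]· subᵇ (exts θ) σ

_[_] : ∀ {S φ} → Basic S (suc φ) → Index S φ → Basic S φ
σ [ I ] = subᵇ (I • var) σ

infix 3 _∣_⊢_⊑_ _∣_⊢_⊑ᵐ_ _∣_⊢_⊑ᶜ_

mutual
  data _∣_⊢_⊑_ (E : Program) {φ} (Φ : Constraints (sig E) φ) :
               Basic (sig E) φ → Basic (sig E) φ → Set where
    nat : ∀ {I J K H} →
          E ∣ Φ ⊨ K ≼ I →
          E ∣ Φ ⊨ J ≼ H →
          E ∣ Φ ⊢ Nat[ I ⋯ J ] ⊑ Nat[ K ⋯ H ]
    fun : ∀ {A B σ τ} →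
          E ∣ Φ ⊢ B ⊑ᵐ A →
          E ∣ Φ ⊢ σ ⊑ τ →
          E ∣ Φ ⊢ A ⊸ σ ⊑ B ⊸ τ

  data _∣_⊢_⊑ᵐ_ (E : Program) {φ} (Φ : Constraints (sig E) φ) :
                Modal (sig E) φ → Modal (sig E) φ → Set where
    mod : ∀ {I J σ τ} →
          E ∣ (Φ ,< I) ⊢ σ ⊑ τ →
          E ∣ Φ ⊨ J ≼ I →
          E ∣ Φ ⊢ [< I ]· σ ⊑ᵐ [< J ]· τ

data _⊎_≔_ {S φ} : Modal S φ → Modal S φ → Modal S φ → Set where
  join : ∀ I J μ →
         ([< I ]· μ) ⊎ ([< J ]· subᵇ ((wk I +ᵢ var zero) • (λ i → var (suc i))) μ)
           ≔ ([< I +ᵢ J ]· μ)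

-- I{d/a} for a term I with bound variable a, placed under a binder of d (the
-- variable zero of the result) in a scope with two more index variables.
under₂ : ∀ {S φ} → Index S (suc φ) → Index S (suc (suc (suc φ)))
under₂ = ren (lift 1 (λ i → suc (suc i)))

-- ∑[< I ] A ≔ B, where A may use the summation variable a (its variable zero).
-- In the substitution below, b is the variable zero and a the variable one.
data ∑[<_]_≔_ {S φ} (I : Index S φ) : Modal S (suc φ) → Modal S φ → Set where
  bounded : ∀ J σ →
            ∑[< I ] ([< J ]· subᵇ ((∑ (var (suc zero)) (under₂ J) +ᵢ var zero)
                                     • (λ i → var (suc (suc i)))) σ)
              ≔ ([< ∑ I J ]· σ)

-- Contexts assign a modal type to each of the n term variables in scope.
Ctx : Signature → ℕ → ℕ → Set
Ctx S φ n = Vec (Modal S φ) n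

_∣_⊢_⊑ᶜ_ : (E : Program) → ∀ {φ n} → Constraints (sig E) φ →
           Ctx (sig E) φ n → Ctx (sig E) φ n → Set
E ∣ Φ ⊢ Γ ⊑ᶜ Δ = ∀ x → E ∣ Φ ⊢ lookup Γ x ⊑ᵐ lookup Δ x

_⊎ᶜ_≔_ : ∀ {S φ n} → Ctx S φ n → Ctx S φ n → Ctx S φ n → Set
Γ ⊎ᶜ Δ ≔ Ξ = ∀ x → lookup Γ x ⊎ lookup Δ x ≔ lookup Ξ x

∑ᶜ[<_]_≔_ : ∀ {S φ n} → Index S φ → Ctx S (suc φ) n → Ctx S φ n → Set
∑ᶜ[< I ] Δ ≔ Ξ = ∀ x → ∑[< I ] lookup Δ x ≔ lookup Ξ x

------------------------------------------------------------------------
-- Terms and PCF typing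

-- Terms with n free variables, as de Bruijn indices.
data Term (n : ℕ) : Set where
  var : Fin n → Term n
  lit : ℕ → Term n
  s p : Term n → Term n
  ƛ   : Term (suc n) → Term n
  _∙_ : Term n → Term n → Term n
  ifz_then_else_ : Term n → Term n → Term n → Term n
  fix : Term (suc n) → Term n

infixr 7 _⇒_
infix  3 _⊢_∶_

data PCFType : Set where
  Nat : PCFType
  _⇒_ : PCFType → PCFType → PCFType

data _⊢_∶_ {n} (Γ : Vec PCFType n) : Term n → PCFType → Set where
  var : ∀ x → Γ ⊢ var x ∶ lookup Γ x
  lit : ∀ k → Γ ⊢ lit k ∶ Nat
  s   : ∀ {t} → Γ ⊢ t ∶ Nat → Γ ⊢ s t ∶ Nat
  p   : ∀ {t} → Γ ⊢ t ∶ Nat → Γ ⊢ p t ∶ Nat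
  ƛ   : ∀ {t σ τ} → σ ∷ Γ ⊢ t ∶ τ → Γ ⊢ ƛ t ∶ σ ⇒ τ
  _∙_ : ∀ {t u σ τ} → Γ ⊢ t ∶ σ ⇒ τ → Γ ⊢ u ∶ σ → Γ ⊢ t ∙ u ∶ τ
  ifz_then_else_ : ∀ {t u v σ} → Γ ⊢ t ∶ Nat → Γ ⊢ u ∶ σ → Γ ⊢ v ∶ σ →
                   Γ ⊢ ifz t then u else v ∶ σ
  fix : ∀ {t σ} → σ ∷ Γ ⊢ t ∶ σ → Γ ⊢ fix t ∶ σ

------------------------------------------------------------------------
-- Typing rules of dℓPCF

infix 3 _∣_︔_⊢[_]_∶_

data _∣_︔_⊢[_]_∶_ (E : Program) {φ} (Φ : Constraints (sig E) φ) {n}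
                    (Σ : Ctx (sig E) φ n) :
                    Index (sig E) φ → Term n → Basic (sig E) φ → Set where

  V : ∀ {x I J σ τ} →
      lookup Σ x ≡ [< I ]· σ →
      E ∣ Φ ⊨ 𝟎 ≼ J →
      E ∣ Φ ⊨ 𝟏 ≼ I →
      E ∣ Φ ⊢ σ [ 𝟎 ] ⊑ τ →
      E ∣ Φ ⊢ Σ ⊑ᶜ Σ →
      E ∣ Φ ︔ Σ ⊢[ J ] var x ∶ τ

  L : ∀ {t A J τ} →
      E ∣ Φ ︔ (A ∷ Σ) ⊢[ J ] t ∶ τ →
      E ∣ Φ ︔ Σ ⊢[ J ] ƛ t ∶ A ⊸ τ

  A : ∀ {t u I J K H σ τ Γ Δ Θ Ξ} →
      E ∣ Φ ︔ Γ ⊢[ J ] t ∶ ([< I ]· σ) ⊸ τ →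
      E ∣ (Φ ,< I) ︔ Δ ⊢[ K ] u ∶ σ →
      ∑ᶜ[< I ] Δ ≔ Θ →
      Γ ⊎ᶜ Θ ≔ Ξ →
      E ∣ Φ ⊢ Σ ⊑ᶜ Ξ →
      E ∣ Φ ⊨ H ≽ J +ᵢ I +ᵢ ∑ I K →
      E ∣ Φ ︔ Σ ⊢[ H ] t ∙ u ∶ τ

  N : ∀ {k I J K} →
      E ∣ Φ ⊨ K ≽ 𝟎 →
      E ∣ Φ ⊨ I ≼ num k →
      E ∣ Φ ⊨ num k ≼ J →
      E ∣ Φ ⊢ Σ ⊑ᶜ Σ →
      E ∣ Φ ︔ Σ ⊢[ K ] lit k ∶ Nat[ I ⋯ J ]

  S : ∀ {t I J K H M} →
      E ∣ Φ ︔ Σ ⊢[ M ] t ∶ Nat[ I ⋯ J ] →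
      E ∣ Φ ⊢ Nat[ I +ᵢ 𝟏 ⋯ J +ᵢ 𝟏 ] ⊑ Nat[ K ⋯ H ] →
      E ∣ Φ ︔ Σ ⊢[ M ] s t ∶ Nat[ K ⋯ H ]

  P : ∀ {t I J K H M} →
      E ∣ Φ ︔ Σ ⊢[ M ] t ∶ Nat[ I ⋯ J ] →
      E ∣ Φ ⊢ Nat[ I ∸ᵢ 𝟏 ⋯ J ∸ᵢ 𝟏 ] ⊑ Nat[ K ⋯ H ] →
      E ∣ Φ ︔ Σ ⊢[ M ] p t ∶ Nat[ K ⋯ H ]

  -- Index terms occurring in types are required to be defined under Φ.  The
  -- other rules guarantee this; here σ is only checked under Φ extended with
  -- I ≤ 𝟎 or J ≥ 𝟏, hence the premise σ ⊑ σ.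
  F : ∀ {t u v I J K H M σ Γ Δ Ξ} →
      E ∣ Φ ︔ Γ ⊢[ K ] t ∶ Nat[ I ⋯ J ] →
      E ∣ ((I ≼ 𝟎) ∷ Φ) ︔ Δ ⊢[ H ] u ∶ σ →
      E ∣ ((J ≽ 𝟏) ∷ Φ) ︔ Δ ⊢[ H ] v ∶ σ →
      E ∣ Φ ⊢ σ ⊑ σ →
      Γ ⊎ᶜ Δ ≔ Ξ →
      E ∣ Φ ⊢ Σ ⊑ᶜ Ξ →
      E ∣ Φ ⊨ M ≽ K +ᵢ H →
      E ∣ Φ ︔ Σ ⊢[ M ] ifz t then u else v ∶ σ

  -- The types τ, Γ and the bound I live in the scope φ, b; σ in φ, b, a.
  R : ∀ {t I K L M N σ τ μ Γ Ξ} →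
      E ∣ (Φ ,< L) ︔ (([< I ]· σ) ∷ Γ) ⊢[ K ] t ∶ τ →
      E ∣ Φ ⊢ τ [ 𝟎 ] ⊑ μ →
      E ∣ ((Φ ,< L) ,< I) ⊢
        subᵇ ((△ (var (suc zero) +ᵢ 𝟏) (var zero) (under₂ I) +ᵢ var (suc zero) +ᵢ 𝟏)
                • (λ i → var (suc (suc i)))) τ
        ⊑ σ →
      ∑ᶜ[< L ] Γ ≔ Ξ →
      E ∣ Φ ⊢ Σ ⊑ᶜ Ξ →
      E ∣ Φ ⊨ △ 𝟎 𝟏 I ≼ L →
      E ∣ Φ ⊨ △ 𝟎 𝟏 I ≼ M →
      E ∣ Φ ⊨ N ≽ (M ∸ᵢ 𝟏) +ᵢ ∑ L K →
      E ∣ Φ ︔ Σ ⊢[ N ] fix t ∶ μ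

------------------------------------------------------------------------
-- The abstract machine

data Closure : Set where
  ⟨_∥_⟩ : ∀ {n} → Term n → Vec Closure n → Closure

Env : ℕ → Set
Env n = Vec Closure n

data Frame : Set where
  arg : Closure → Frame
  s p : Frame
  ifz : ∀ {n} → Term n → Term n → Env n → Frame

data Config : Set where
  ⟨_∥_∥_⟩ : ∀ {n} → Term n → Env n → List Frame → Config

infix 3 _⟶_ _⟶[_]_

data _⟶_ : Config → Config → Set where
  app  : ∀ {n} {t u : Term n} {ρ ξ} →
         ⟨ t ∙ u ∥ ρ ∥ ξ ⟩ ⟶ ⟨ t ∥ ρ ∥ arg ⟨ u ∥ ρ ⟩ ∷ ξ ⟩
  lam  : ∀ {n} {t : Term (suc n)} {ρ c ξ} →
         ⟨ ƛ t ∥ ρ ∥ arg c ∷ ξ ⟩ ⟶ ⟨ t ∥ c ∷ ρ ∥ ξ ⟩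
  var  : ∀ {n k} {x : Fin n} {ρ ξ} {t : Term k} {μ} →
         lookup ρ x ≡ ⟨ t ∥ μ ⟩ →
         ⟨ var x ∥ ρ ∥ ξ ⟩ ⟶ ⟨ t ∥ μ ∥ ξ ⟩
  ifz  : ∀ {n} {t u v : Term n} {ρ ξ} →
         ⟨ ifz t then u else v ∥ ρ ∥ ξ ⟩ ⟶ ⟨ t ∥ ρ ∥ ifz u v ρ ∷ ξ ⟩
  fix  : ∀ {n} {t : Term (suc n)} {ρ ξ} →
         ⟨ fix t ∥ ρ ∥ ξ ⟩ ⟶ ⟨ t ∥ ⟨ fix t ∥ ρ ⟩ ∷ ρ ∥ ξ ⟩
  lit-s : ∀ {n k} {ρ : Env n} {ξ} →
          ⟨ lit k ∥ ρ ∥ s ∷ ξ ⟩ ⟶ ⟨ lit {n} (suc k) ∥ ρ ∥ ξ ⟩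
  lit-p : ∀ {n k} {ρ : Env n} {ξ} →
          ⟨ lit k ∥ ρ ∥ p ∷ ξ ⟩ ⟶ ⟨ lit {n} (k ∸ 1) ∥ ρ ∥ ξ ⟩
  lit-zero : ∀ {n k} {ρ : Env n} {t u : Term k} {μ ξ} →
             ⟨ lit 0 ∥ ρ ∥ ifz t u μ ∷ ξ ⟩ ⟶ ⟨ t ∥ μ ∥ ξ ⟩
  lit-suc  : ∀ {n k j} {ρ : Env n} {t u : Term k} {μ ξ} →
             ⟨ lit (suc j) ∥ ρ ∥ ifz t u μ ∷ ξ ⟩ ⟶ ⟨ u ∥ μ ∥ ξ ⟩
  s    : ∀ {n} {t : Term n} {ρ ξ} → ⟨ s t ∥ ρ ∥ ξ ⟩ ⟶ ⟨ t ∥ ρ ∥ s ∷ ξ ⟩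
  p    : ∀ {n} {t : Term n} {ρ ξ} → ⟨ p t ∥ ρ ∥ ξ ⟩ ⟶ ⟨ t ∥ ρ ∥ p ∷ ξ ⟩

data _⟶[_]_ : Config → ℕ → Config → Set where
  done : ∀ {C} → C ⟶[ 0 ] C
  step : ∀ {C D C′ n} → C ⟶ D → D ⟶[ n ] C′ → C ⟶[ suc n ] C′

_⇓[_]_ : Term 0 → ℕ → ℕ → Set
t ⇓[ n ] m = ∃ λ k → ∃ λ (ρ : Env k) → ⟨ t ∥ [] ∥ [] ⟩ ⟶[ n ] ⟨ lit m ∥ ρ ∥ [] ⟩

{-# OPTIONS --safe #-}
module Submission where

-- A terminating run needs only finitely many resources.  Expanding it backwards from
-- its final configuration yields a derivation of t in a non-idempotent intersection
-- type system, in which an argument type is the list of the types at which the argument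
-- is used; the weight counts the variable lookups, hence is at most n.  A dℓPCF
-- derivation is a finite family of such derivations, one for every assignment that
-- satisfies the constraints: the bounds [a < I] are the lengths of the lists, ⊎ and ∑
-- are concatenations, and △ numbers the unfoldings of a fixpoint in pre-order.  Since
-- the families are finite, the index terms involved are tables, which are definable
-- from 𝟎, 𝟏, +, ∸ and ∑.

open import Defs
open import Data.Empty using (⊥-elim)
open import Data.Fin.Base using (Fin; zero; suc; lift)
open import Data.List.Base using (List; []; _∷_; _++_; length; map; concat; take)
open import Data.List.Properties using (++-identityʳ; length-map; length-++; map-++; concat-++)
open import Data.List.Relation.Unary.All as All using (All; []; _∷_)
open import Data.List.Relation.Unary.All.Properties using (map⁺; map⁻)
open import Data.Maybe.Base as Maybe using (Maybe; just; nothing; _>>=_)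
open import Data.Nat.Base using (ℕ; zero; suc; _+_; _∸_; _≤_; _<_; _⊔_; z≤n; s≤s)
open import Data.Nat.ListAction renaming (sum to Σ⟨_⟩)
open import Data.Nat.ListAction.Properties using (sum-++)
open import Data.Nat.Properties
open import Data.Nat.Tactic.RingSolver using (solve-∀)
open import Data.Product.Base using (Σ; ∃; ∃₂; _×_; _,_; proj₁; proj₂)
open import Data.Sum.Base using (_⊎_; inj₁; inj₂; [_,_]′)
open import Data.Unit.Base using (⊤; tt)
open import Data.Vec.Base using (Vec; []; _∷_; lookup; tabulate)
open import Data.Vec.Functional using () renaming (_∷_ to _•_)
open import Data.Vec.Properties using (lookup∘tabulate)
open import Data.Vec.Relation.Binary.Pointwise.Inductive using (Pointwise; []; _∷_)
import Data.Vec.Relation.Unary.All as Vec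
open import Function.Base using (id; _∘_)
open import Relation.Binary.PropositionalEquality hiding ([_])

-- The obstacle is syntactic: `⊎` and `∑` combine types only if these are literally restrictions or
-- shifts of one common type, which independently built typings of subterms would not be. Types
-- therefore flow from the conclusion to the premises: at each rule the types of all uses of a
-- variable are tabulated once, and the premises receive segments of that table. This works because
-- the induction accepts arbitrary index terms and types, as long as their values in the models of
-- the constraints are the prescribed ones; `⊑` then only relates types with equal values. Its
-- constraints then have no model and only the PCF derivation guides the typing, whence the
-- recursion on PCF derivations.

private variable
  n φ ψ : ℕ
  σ τ : PCFType
  X Y : Set

-- Lists

nth : List X → ℕ → Maybe X
nth []       _       = nothing
nth (x ∷ xs) zero    = just x
nth (x ∷ xs) (suc i) = nth xs i

nth-< : ∀ (xs : List X) {i} → i < length xs → ∃ λ x → nth xs i ≡ just x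
nth-< (x ∷ xs) {zero}  _         = x , refl
nth-< (x ∷ xs) {suc i} (s≤s i<) = nth-< xs i<

nth-just⇒< : ∀ (xs : List X) i {x} → nth xs i ≡ just x → i < length xs
nth-just⇒< (x ∷ xs) zero    _  = s≤s z≤n
nth-just⇒< (x ∷ xs) (suc i) eq = s≤s (nth-just⇒< xs i eq)

nth-++ˡ : ∀ (xs : List X) {ys} i {x} → nth xs i ≡ just x → nth (xs ++ ys) i ≡ just x
nth-++ˡ (x ∷ xs) zero    eq = eq
nth-++ˡ (x ∷ xs) (suc i) eq = nth-++ˡ xs i eq

nth-++ʳ : ∀ (xs : List X) {ys} i → nth (xs ++ ys) (length xs + i) ≡ nth ys i
nth-++ʳ []       i = refl
nth-++ʳ (x ∷ xs) i = nth-++ʳ xs i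

nth-++⁻ : ∀ (xs : List X) {ys} i {x} → nth (xs ++ ys) i ≡ just x →
          nth xs i ≡ just x ⊎ ∃ λ j → i ≡ length xs + j × nth ys j ≡ just x
nth-++⁻ []       i       eq = inj₂ (i , refl , eq)
nth-++⁻ (x ∷ xs) zero    eq = inj₁ eq
nth-++⁻ (x ∷ xs) (suc i) eq with nth-++⁻ xs i eq
... | inj₁ eq′              = inj₁ eq′
... | inj₂ (j , refl , eq′) = inj₂ (j , refl , eq′)

nth-map : ∀ (f : X → Y) xs i {x} → nth xs i ≡ just x → nth (map f xs) i ≡ just (f x)
nth-map f (x ∷ xs) zero    refl = refl
nth-map f (x ∷ xs) (suc i) eq   = nth-map f xs i eq

Σ-take-suc : ∀ (f : X → ℕ) xs k {x} → nth xs k ≡ just x →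
             Σ⟨ map f (take (suc k) xs) ⟩ ≡ Σ⟨ map f (take k xs) ⟩ + f x
Σ-take-suc f (x ∷ xs) zero    refl = +-comm (f x) 0
Σ-take-suc f (x ∷ xs) (suc k) eq   =
  trans (cong (f x +_) (Σ-take-suc f xs k eq)) (sym (+-assoc (f x) _ _))

take-length : (xs : List X) → take (length xs) xs ≡ xs
take-length []       = refl
take-length (x ∷ xs) = cong (x ∷_) (take-length xs)

length-concat : (xss : List (List X)) → length (concat xss) ≡ Σ⟨ map length xss ⟩
length-concat []         = refl
length-concat (xs ∷ xss) = trans (length-++ xs) (cong (length xs +_) (length-concat xss))

-- The offset, the total length of the preceding lists, is the value of the sum in the definition of
-- `∑[<_]_≔_`.
nth-concat : ∀ (xss : List (List X)) a {xs b x} → nth xss a ≡ just xs → nth xs b ≡ just x →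
             nth (concat xss) (Σ⟨ map length (take a xss) ⟩ + b) ≡ just x
nth-concat (xs ∷ xss) zero    {b = b} refl eq = nth-++ˡ xs b eq
nth-concat (xs ∷ xss) (suc a) {b = b} eqs  eq =
  trans (cong (nth (xs ++ concat xss)) (+-assoc (length xs) _ b))
        (trans (nth-++ʳ xs _) (nth-concat xss a eqs eq))

concat-map-++ : ∀ (f : X → List Y) xs ys →
                concat (map f xs) ++ concat (map f ys) ≡ concat (map f (xs ++ ys))
concat-map-++ f xs ys =
  trans (concat-++ (map f xs) (map f ys)) (cong concat (sym (map-++ f xs ys)))

Σ-map-++ : ∀ (f : X → ℕ) xs ys → Σ⟨ map f (xs ++ ys) ⟩ ≡ Σ⟨ map f xs ⟩ + Σ⟨ map f ys ⟩
Σ-map-++ f xs ys = trans (cong Σ⟨_⟩ (map-++ f xs ys)) (sum-++ (map f xs) (map f ys))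

nth-map⁻ : ∀ (f : X → Y) xs i {y} → nth (map f xs) i ≡ just y →
           ∃ λ x → nth xs i ≡ just x × y ≡ f x
nth-map⁻ f (x ∷ xs) zero    refl = x , refl , refl
nth-map⁻ f (x ∷ xs) (suc i) eq   = nth-map⁻ f xs i eq

>>=-just⁻ : ∀ (x : Maybe X) (f : X → Maybe Y) {y} → (x >>= f) ≡ just y →
            ∃ λ z → x ≡ just z × f z ≡ just y
>>=-just⁻ (just x) f eq = x , refl , eq

lookup-tabulate : ∀ (Q : Fin n → X → Set) {f : Fin n → X} → (∀ x → Q x (f x)) →
                  ∀ x → Q x (lookup (tabulate f) x)
lookup-tabulate Q {f} h x = subst (Q x) (sym (lookup∘tabulate f x)) (h x)

lookup-tabulate₃ : ∀ (Q : X → X → X → Set) {f g h : Fin n → X} → (∀ x → Q (f x) (g x) (h x)) →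
                   ∀ x → Q (lookup (tabulate f) x) (lookup (tabulate g) x) (lookup (tabulate h) x)
lookup-tabulate₃ Q {f} {g} {h} r x
  rewrite lookup∘tabulate f x | lookup∘tabulate g x | lookup∘tabulate h x = r x

lookup-tabulate₂ : ∀ (Q : X → Y → Set) {f : Fin n → X} {g : Fin n → Y} → (∀ x → Q (f x) (g x)) →
                   ∀ x → Q (lookup (tabulate f) x) (lookup (tabulate g) x)
lookup-tabulate₂ Q {f} {g} r x rewrite lookup∘tabulate f x | lookup∘tabulate g x = r x

-- △ numbers nodes by their position in a single list, so a subtree is followed as a segment of the
-- whole enumeration.
Located : List X → ℕ → List X → Set
Located ys o xs = ∀ i {x} → nth xs i ≡ just x → nth ys (o + i) ≡ just x

-- Evaluation of index terms

module Evaluation (E : Program) where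

  Agree : (Fin φ → Fin ψ) → Vec ℕ φ → Vec ℕ ψ → Set
  Agree θ ρ ρ′ = ∀ i → lookup ρ′ (θ i) ≡ lookup ρ i

  lift-Agree : ∀ {θ : Fin φ → Fin ψ} {ρ ρ′} n → Agree θ ρ ρ′ → Agree (lift 1 θ) (n ∷ ρ) (n ∷ ρ′)
  lift-Agree n h zero    = refl
  lift-Agree n h (suc i) = h i

  mutual
    ren-⇓ : ∀ {θ : Fin φ → Fin ψ} {ρ ρ′ I v} → Agree θ ρ ρ′ →
            E ∣ ρ ⊢ I ⇓ v → E ∣ ρ′ ⊢ ren θ I ⇓ v
    ren-⇓ h (var i)          = subst (E ∣ _ ⊢ var _ ⇓_) (h i) (var _)
    ren-⇓ h (app vs e)       = app (ren-⇓* h vs) e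
    ren-⇓ h (sum e es)       = sum (ren-⇓ h e) (ren-Sum h es)
    ren-⇓ h (forest e e′ es) = forest (ren-⇓ h e) (ren-⇓ h e′) (ren-Forest h es)

    ren-⇓* : ∀ {θ : Fin φ → Fin ψ} {ρ ρ′ k vs} {Is : Vec _ k} → Agree θ ρ ρ′ →
             Pointwise (E ∣ ρ ⊢_⇓_) Is vs → Pointwise (E ∣ ρ′ ⊢_⇓_) (renVec θ Is) vs
    ren-⇓* h []       = []
    ren-⇓* h (e ∷ es) = ren-⇓ h e ∷ ren-⇓* h es

    ren-Sum : ∀ {θ : Fin φ → Fin ψ} {ρ ρ′ J n v} → Agree θ ρ ρ′ →
              Sum E ρ J n v → Sum E ρ′ (ren (lift 1 θ) J) n v
    ren-Sum h zero       = zero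
    ren-Sum h (suc es e) = suc (ren-Sum h es) (ren-⇓ (lift-Agree _ h) e)

    ren-Forest : ∀ {θ : Fin φ → Fin ψ} {ρ ρ′ K i j v} → Agree θ ρ ρ′ →
                 Forest E ρ K i j v → Forest E ρ′ (ren (lift 1 θ) K) i j v
    ren-Forest h zero           = zero
    ren-Forest h (suc es e es′) =
      suc (ren-Forest h es) (ren-⇓ (lift-Agree _ h) e) (ren-Forest h es′)

  mutual
    -- A model of `Φ ,< I` evaluates weakened terms, while families are given on models of `Φ`, so
    -- weakening has to be undone. The recursion is on `I`, since `ren θ I` hides its head.
    unren-⇓ : ∀ {θ : Fin φ → Fin ψ} {ρ ρ′ v} I → Agree θ ρ ρ′ →
              E ∣ ρ′ ⊢ ren θ I ⇓ v → E ∣ ρ ⊢ I ⇓ v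
    unren-⇓ (var i)   h (var _)          = subst (E ∣ _ ⊢ var _ ⇓_) (sym (h i)) (var _)
    unren-⇓ (f $ Is)  h (app vs e)       = app (unren-⇓* Is h vs) e
    unren-⇓ (∑ I J)   h (sum e es)       = sum (unren-⇓ I h e) (unren-Sum J h es)
    unren-⇓ (△ I J K) h (forest e e′ es) =
      forest (unren-⇓ I h e) (unren-⇓ J h e′) (unren-Forest K h es)

    unren-⇓* : ∀ {θ : Fin φ → Fin ψ} {ρ ρ′ k vs} (Is : Vec _ k) → Agree θ ρ ρ′ →
               Pointwise (E ∣ ρ′ ⊢_⇓_) (renVec θ Is) vs → Pointwise (E ∣ ρ ⊢_⇓_) Is vs
    unren-⇓* []       h []       = []
    unren-⇓* (I ∷ Is) h (e ∷ es) = unren-⇓ I h e ∷ unren-⇓* Is h es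

    unren-Sum : ∀ {θ : Fin φ → Fin ψ} {ρ ρ′ n v} J → Agree θ ρ ρ′ →
                Sum E ρ′ (ren (lift 1 θ) J) n v → Sum E ρ J n v
    unren-Sum J h zero       = zero
    unren-Sum J h (suc es e) = suc (unren-Sum J h es) (unren-⇓ J (lift-Agree _ h) e)

    unren-Forest : ∀ {θ : Fin φ → Fin ψ} {ρ ρ′ i j v} K → Agree θ ρ ρ′ →
                   Forest E ρ′ (ren (lift 1 θ) K) i j v → Forest E ρ K i j v
    unren-Forest K h zero           = zero
    unren-Forest K h (suc es e es′) =
      suc (unren-Forest K h es) (unren-⇓ K (lift-Agree _ h) e) (unren-Forest K h es′)

  wk-⇓ : ∀ {ρ : Vec ℕ φ} {a I v} → E ∣ ρ ⊢ I ⇓ v → E ∣ a ∷ ρ ⊢ wk I ⇓ v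
  wk-⇓ = ren-⇓ λ _ → refl

  unwk-⇓ : ∀ {ρ : Vec ℕ φ} {a v} I → E ∣ a ∷ ρ ⊢ wk I ⇓ v → E ∣ ρ ⊢ I ⇓ v
  unwk-⇓ I = unren-⇓ I λ _ → refl

  Values : Subst (sig E) φ ψ → Vec ℕ φ → Vec ℕ ψ → Set
  Values θ ρ ρ′ = ∀ i → E ∣ ρ′ ⊢ θ i ⇓ lookup ρ i

  exts-Values : ∀ {θ : Subst (sig E) φ ψ} {ρ ρ′} n → Values θ ρ ρ′ →
                Values (exts θ) (n ∷ ρ) (n ∷ ρ′)
  exts-Values n h zero    = var zero
  exts-Values n h (suc i) = wk-⇓ (h i)

  mutual
    sub-⇓ : ∀ {θ : Subst (sig E) φ ψ} {ρ ρ′ I v} → Values θ ρ ρ′ →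
            E ∣ ρ ⊢ I ⇓ v → E ∣ ρ′ ⊢ sub θ I ⇓ v
    sub-⇓ h (var i)          = h i
    sub-⇓ h (app vs e)       = app (sub-⇓* h vs) e
    sub-⇓ h (sum e es)       = sum (sub-⇓ h e) (sub-Sum h es)
    sub-⇓ h (forest e e′ es) = forest (sub-⇓ h e) (sub-⇓ h e′) (sub-Forest h es)

    sub-⇓* : ∀ {θ : Subst (sig E) φ ψ} {ρ ρ′ k vs} {Is : Vec _ k} → Values θ ρ ρ′ →
             Pointwise (E ∣ ρ ⊢_⇓_) Is vs → Pointwise (E ∣ ρ′ ⊢_⇓_) (subVec θ Is) vs
    sub-⇓* h []       = []
    sub-⇓* h (e ∷ es) = sub-⇓ h e ∷ sub-⇓* h es

    sub-Sum : ∀ {θ : Subst (sig E) φ ψ} {ρ ρ′ J n v} → Values θ ρ ρ′ →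
              Sum E ρ J n v → Sum E ρ′ (sub (exts θ) J) n v
    sub-Sum h zero       = zero
    sub-Sum h (suc es e) = suc (sub-Sum h es) (sub-⇓ (exts-Values _ h) e)

    sub-Forest : ∀ {θ : Subst (sig E) φ ψ} {ρ ρ′ K i j v} → Values θ ρ ρ′ →
                 Forest E ρ K i j v → Forest E ρ′ (sub (exts θ) K) i j v
    sub-Forest h zero           = zero
    sub-Forest h (suc es e es′) =
      suc (sub-Forest h es) (sub-⇓ (exts-Values _ h) e) (sub-Forest h es′)

  𝟎-⇓ : ∀ {ρ : Vec ℕ φ} → E ∣ ρ ⊢ 𝟎 ⇓ 0
  𝟎-⇓ = app [] zero

  𝟏-⇓ : ∀ {ρ : Vec ℕ φ} → E ∣ ρ ⊢ 𝟏 ⇓ 1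
  𝟏-⇓ = app [] one

  +-⇓ : ∀ {ρ : Vec ℕ φ} {I J v w} → E ∣ ρ ⊢ I ⇓ v → E ∣ ρ ⊢ J ⇓ w → E ∣ ρ ⊢ I +ᵢ J ⇓ (v + w)
  +-⇓ e e′ = app (e ∷ e′ ∷ []) (plus _ _)

  ∸-⇓ : ∀ {ρ : Vec ℕ φ} {I J v w} → E ∣ ρ ⊢ I ⇓ v → E ∣ ρ ⊢ J ⇓ w → E ∣ ρ ⊢ I ∸ᵢ J ⇓ (v ∸ w)
  ∸-⇓ e e′ = app (e ∷ e′ ∷ []) (monus _ _)

  num-⇓ : ∀ {ρ : Vec ℕ φ} k → E ∣ ρ ⊢ num k ⇓ k
  num-⇓ zero          = 𝟎-⇓
  num-⇓ (suc zero)    = 𝟏-⇓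
  num-⇓ {ρ = ρ} (suc (suc k)) =
    subst (λ v → E ∣ ρ ⊢ num (suc (suc k)) ⇓ v) (+-comm (suc k) 1) (+-⇓ (num-⇓ (suc k)) 𝟏-⇓)

  -- `Sum` grows at its last summand, hence the prefixes of `xs`. The partial sums also serve as the
  -- offsets in `split-∑`.
  Sum-nth : ∀ {ρ : Vec ℕ φ} {J} (f : X → ℕ) xs →
            (∀ a {x} → nth xs a ≡ just x → E ∣ a ∷ ρ ⊢ J ⇓ f x) →
            ∀ k → k ≤ length xs → Sum E ρ J k Σ⟨ map f (take k xs) ⟩
  Sum-nth f xs h zero    _  = zero
  Sum-nth f xs h (suc k) k< with nth-< xs k<
  ... | x , eq = subst (Sum E _ _ _) (sym (Σ-take-suc f xs k eq))
                       (suc (Sum-nth f xs h k (<⇒≤ k<)) (h k eq))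

  ∑-⇓ : ∀ {ρ : Vec ℕ φ} {I J} (f : X → ℕ) xs → E ∣ ρ ⊢ I ⇓ length xs →
        (∀ a {x} → nth xs a ≡ just x → E ∣ a ∷ ρ ⊢ J ⇓ f x) →
        E ∣ ρ ⊢ ∑ I J ⇓ Σ⟨ map f xs ⟩
  ∑-⇓ f xs e h =
    sum e (subst (Sum E _ _ _) (cong (Σ⟨_⟩ ∘ map f) (take-length xs)) (Sum-nth f xs h _ ≤-refl))

-- Intersection types

-- l ↣ s′ is the type of the functions that use their argument length l times, the
-- i-th time at the type nth l i.
infixr 7 _↣_

data Ty : PCFType → Set where
  nat : ℕ → Ty Nat
  _↣_ : List (Ty σ) → Ty τ → Ty (σ ⇒ τ)

value : Ty Nat → ℕ
value (nat k) = k

mapNat : (ℕ → ℕ) → Ty Nat → Ty Nat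
mapNat f (nat k) = nat (f k)

dom : Ty (σ ⇒ τ) → List (Ty σ)
dom (l ↣ _) = l

cod : Ty (σ ⇒ τ) → Ty τ
cod (_ ↣ s′) = s′

mutual
  -- Instances say nothing when the constraints have no model, yet `⊑` still needs types of the same
  -- form. The skeleton is therefore recorded independently of any assignment.
  data Shape {S φ} : Basic S φ → PCFType → Set where
    nat : ∀ {I J} → Shape Nat[ I ⋯ J ] Nat
    fun : ∀ {A b} → Shapeᵐ A σ → Shape b τ → Shape (A ⊸ b) (σ ⇒ τ)

  data Shapeᵐ {S φ} : Modal S φ → PCFType → Set where
    mod : ∀ {I a} → Shape a σ → Shapeᵐ ([< I ]· a) σ

mutual
  sub-Shape : ∀ {S} {θ : Subst S φ ψ} {a} → Shape a σ → Shape (subᵇ θ a) σ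
  sub-Shape nat        = nat
  sub-Shape (fun a b) = fun (sub-Shapeᵐ a) (sub-Shape b)

  sub-Shapeᵐ : ∀ {S} {θ : Subst S φ ψ} {A} → Shapeᵐ A σ → Shapeᵐ (subᵐ θ A) σ
  sub-Shapeᵐ (mod a) = mod (sub-Shape a)

-- Finite functions as index terms

mutual
  maximum : ℕ → (Vec ℕ φ → ℕ) → ℕ
  maximum {zero}  B f = f []
  maximum {suc φ} B f = maximumBelow B B f

  maximumBelow : ℕ → ℕ → (Vec ℕ (suc φ) → ℕ) → ℕ
  maximumBelow B zero    f = 0
  maximumBelow B (suc k) f = maximumBelow B k f ⊔ maximum B (f ∘ (k ∷_))

mutual
  ≤-maximum : ∀ B (f : Vec ℕ φ → ℕ) {ρ} → Vec.All (_< B) ρ → f ρ ≤ maximum B f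
  ≤-maximum B f {[]}    Vec.[]          = ≤-refl
  ≤-maximum B f {a ∷ ρ} (a<B Vec.∷ ρ<B) = ≤-maximumBelow B B f a<B ρ<B

  ≤-maximumBelow : ∀ B k (f : Vec ℕ (suc φ) → ℕ) {a ρ} → a < k → Vec.All (_< B) ρ →
                   f (a ∷ ρ) ≤ maximumBelow B k f
  ≤-maximumBelow B (suc k) f {a} a<1+k ρ<B with m≤n⇒m<n∨m≡n (≤-pred a<1+k)
  ... | inj₁ a<k  = ≤-trans (≤-maximumBelow B k f a<k ρ<B) (m≤m⊔n _ _)
  ... | inj₂ refl = ≤-trans (≤-maximum B (f ∘ (a ∷_)) ρ<B) (m≤n⊔m (maximumBelow B k f) _)

-- The summation bound 1 ∸ (k ∸ a) is 0 if a < k and 1 otherwise.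
mutual
  table : ∀ {S} → ℕ → (Vec ℕ φ → ℕ) → Index S φ
  table {zero}  B f = num (f [])
  table {suc φ} B f = tableBelow B B f

  tableBelow : ∀ {S} → ℕ → ℕ → (Vec ℕ (suc φ) → ℕ) → Index S (suc φ)
  tableBelow B zero    f = 𝟎
  tableBelow B (suc k) f =
    ∑ (𝟏 ∸ᵢ (𝟏 ∸ᵢ (num k ∸ᵢ var zero))) (wk (tableBelow B k f)) +ᵢ
    ∑ (𝟏 ∸ᵢ (num k ∸ᵢ var zero)) (wk (wk (table B (f ∘ (k ∷_)))))

module Instances (E : Program) where

  open Evaluation E

  ⇓-≡ : ∀ {ρ : Vec ℕ φ} {I v w} → v ≡ w → E ∣ ρ ⊢ I ⇓ v → E ∣ ρ ⊢ I ⇓ w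
  ⇓-≡ refl e = e

  -- An empty sum does not evaluate its body, so the part of a table that is not selected needs no
  -- value.
  none-⇓ : ∀ {ρ : Vec ℕ φ} {I J} → E ∣ ρ ⊢ I ⇓ 0 → E ∣ ρ ⊢ ∑ I J ⇓ 0
  none-⇓ e = sum e zero

  once-⇓ : ∀ {ρ : Vec ℕ φ} {I J v} → E ∣ ρ ⊢ I ⇓ 1 → E ∣ ρ ⊢ J ⇓ v → E ∣ ρ ⊢ ∑ I (wk J) ⇓ v
  once-⇓ e e′ = sum e (suc zero (wk-⇓ e′))

  mutual
    table-⇓ : ∀ B (f : Vec ℕ φ → ℕ) {ρ} → Vec.All (_< B) ρ → E ∣ ρ ⊢ table B f ⇓ f ρ
    table-⇓ B f {[]}    Vec.[]          = num-⇓ _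
    table-⇓ B f {a ∷ ρ} (a<B Vec.∷ ρ<B) = tableBelow-⇓ B B f a<B ρ<B

    tableBelow-⇓ : ∀ B k (f : Vec ℕ (suc φ) → ℕ) {a ρ} → a < k → Vec.All (_< B) ρ →
                   E ∣ a ∷ ρ ⊢ tableBelow B k f ⇓ f (a ∷ ρ)
    tableBelow-⇓ B (suc k) f {a} {ρ} a<1+k ρ<B = case (m≤n⇒m<n∨m≡n (≤-pred a<1+k))
      where
      beyond : E ∣ a ∷ ρ ⊢ 𝟏 ∸ᵢ (num k ∸ᵢ var zero) ⇓ (1 ∸ (k ∸ a))
      beyond = ∸-⇓ 𝟏-⇓ (∸-⇓ (num-⇓ k) (var zero))

      case : a < k ⊎ a ≡ k → E ∣ a ∷ ρ ⊢ tableBelow B (suc k) f ⇓ f (a ∷ ρ)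
      case (inj₁ a<k) = ⇓-≡ (+-identityʳ _)
        (+-⇓ (once-⇓ (⇓-≡ (cong (1 ∸_) 0≡) (∸-⇓ 𝟏-⇓ beyond)) (tableBelow-⇓ B k f a<k ρ<B))
             (none-⇓ (⇓-≡ 0≡ beyond)))
        where
        0≡ : 1 ∸ (k ∸ a) ≡ 0
        0≡ = m≤n⇒m∸n≡0 (m<n⇒0<n∸m a<k)
      case (inj₂ refl) =
        +-⇓ (none-⇓ (⇓-≡ (cong (1 ∸_) 1≡) (∸-⇓ 𝟏-⇓ beyond)))
            (once-⇓ (⇓-≡ 1≡ beyond) (wk-⇓ (table-⇓ B (f ∘ (a ∷_)) ρ<B)))
        where
        1≡ : 1 ∸ (a ∸ a) ≡ 1
        1≡ = cong (1 ∸_) (n∸n≡0 a)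

  infix 4 _⊩_∋_ _⊩ᵐ_∋_

  -- ρ ⊩ a ∋ s′: the values of the index terms of a in ρ are those in s′.
  mutual
    data _⊩_∋_ (ρ : Vec ℕ φ) : Basic (sig E) φ → Ty σ → Set where
      -- Both ends share one value: every interval in the construction is a single number.
      nat : ∀ {I J k} → E ∣ ρ ⊢ I ⇓ k → E ∣ ρ ⊢ J ⇓ k → ρ ⊩ Nat[ I ⋯ J ] ∋ nat k
      fun : ∀ {A b} {l : List (Ty σ)} {s′ : Ty τ} →
            ρ ⊩ᵐ A ∋ l → ρ ⊩ b ∋ s′ → ρ ⊩ A ⊸ b ∋ (l ↣ s′)

    data _⊩ᵐ_∋_ (ρ : Vec ℕ φ) : Modal (sig E) φ → List (Ty σ) → Set where
      mod : ∀ {I a} {l : List (Ty σ)} → E ∣ ρ ⊢ I ⇓ length l → Entries ρ a l →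
            ρ ⊩ᵐ [< I ]· a ∋ l

    Entries : Vec ℕ φ → Basic (sig E) (suc φ) → List (Ty σ) → Set
    Entries ρ a l = ∀ i {s′} → nth l i ≡ just s′ → (i ∷ ρ) ⊩ a ∋ s′

  mutual
    sub-⊩ : ∀ {θ : Subst (sig E) φ ψ} {ρ ρ′ a} {s′ : Ty σ} → Values θ ρ ρ′ →
            ρ ⊩ a ∋ s′ → ρ′ ⊩ subᵇ θ a ∋ s′
    sub-⊩ h (nat e e′) = nat (sub-⇓ h e) (sub-⇓ h e′)
    sub-⊩ h (fun a b)  = fun (sub-⊩ᵐ h a) (sub-⊩ h b)

    sub-⊩ᵐ : ∀ {θ : Subst (sig E) φ ψ} {ρ ρ′ A} {l : List (Ty σ)} → Values θ ρ ρ′ →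
             ρ ⊩ᵐ A ∋ l → ρ′ ⊩ᵐ subᵐ θ A ∋ l
    sub-⊩ᵐ h (mod e a) = mod (sub-⇓ h e) λ i eq → sub-⊩ (exts-Values i h) (a i eq)

  mutual
    -- Each numeric leaf of the type becomes one table over all index variables in its scope. `g` is
    -- partial because nothing is prescribed at assignments outside the family.
    reify : ∀ B (g : Vec ℕ φ → Maybe (Ty σ)) →
            ∃ λ a → Shape a σ × (∀ {ρ s′} → Vec.All (_< B) ρ → g ρ ≡ just s′ → ρ ⊩ a ∋ s′)
    reify {σ = Nat} B g = Nat[ I ] , nat , h
      where
      -- The default 0 fills the places where `g` is undefined, about which nothing is claimed.
      I = table B (Maybe.maybe′ value 0 ∘ g)
      h : ∀ {ρ s′} → Vec.All (_< B) ρ → g ρ ≡ just s′ → ρ ⊩ Nat[ I ] ∋ s′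
      h {ρ} {nat k} ρ<B eq = nat e e
        where e = ⇓-≡ (cong (Maybe.maybe′ value 0) eq) (table-⇓ B _ ρ<B)
    reify {σ = σ ⇒ τ} B g with reifyᵐ B (Maybe.map dom ∘ g) | reify B (Maybe.map cod ∘ g)
    ... | _ , a-shape , ha | _ , b-shape , hb = _ , fun a-shape b-shape ,
      λ { {s′ = l ↣ s′} ρ<B eq → fun (ha ρ<B (cong (Maybe.map dom) eq))
                                     (hb ρ<B (cong (Maybe.map cod) eq)) }

    reifyᵐ : ∀ B (g : Vec ℕ φ → Maybe (List (Ty σ))) →
             ∃ λ A → Shapeᵐ A σ × (∀ {ρ l} → Vec.All (_< B) ρ → g ρ ≡ just l → ρ ⊩ᵐ A ∋ l)
    reifyᵐ {φ} {σ} B g = [< I ]· proj₁ body , mod (proj₁ (proj₂ body)) , h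
      where
      len : Vec ℕ φ → ℕ
      len = Maybe.maybe′ length 0 ∘ g
      I = table B len
      -- The variable bound by the modality runs below the list lengths, which may exceed `B`; the
      -- tables in the body must cover both ranges.
      B′ = B ⊔ maximum B len
      g′ : Vec ℕ (suc φ) → Maybe (Ty σ)
      g′ (i ∷ ρ) = g ρ >>= λ l → nth l i
      body = reify B′ g′
      h : ∀ {ρ l} → Vec.All (_< B) ρ → g ρ ≡ just l → ρ ⊩ᵐ [< I ]· proj₁ body ∋ l
      h {ρ} {l} ρ<B eq = mod (⇓-≡ len≡ (table-⇓ B _ ρ<B)) λ i eq′ →
        proj₂ (proj₂ body)
          (<-≤-trans (nth-just⇒< l i eq′)
                     (subst (_≤ B′) len≡ (≤-trans (≤-maximum B len ρ<B) (m≤n⊔m B _)))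
           Vec.∷ Vec.map (λ a<B → <-≤-trans a<B (m≤m⊔n B _)) ρ<B)
          (trans (cong (_>>= λ l → nth l i) eq) eq′)
        where len≡ = cong (Maybe.maybe′ length 0) eq

-- Derivations with intersection types

Uses : Vec PCFType n → Set
Uses Γ = ∀ x → List (Ty (lookup Γ x))

once : ∀ (Γ : Vec PCFType n) x → Ty (lookup Γ x) → Uses Γ
once (_ ∷ Γ) zero    s′ zero    = s′ ∷ []
once (_ ∷ Γ) zero    s′ (suc y) = []
once (_ ∷ Γ) (suc x) s′ zero    = []
once (_ ∷ Γ) (suc x) s′ (suc y) = once Γ x s′ y

once-same : ∀ (Γ : Vec PCFType n) x s′ → once Γ x s′ x ≡ s′ ∷ []
once-same (_ ∷ Γ) zero    s′ = refl
once-same (_ ∷ Γ) (suc x) s′ = once-same Γ x s′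

-- A set of intersection type derivations for one PCF derivation, with their
-- contexts, types and weights.
record Derivations (Γ : Vec PCFType n) (σ : PCFType) : Set₁ where
  field
    Carrier : Set
    ctx     : Carrier → Uses Γ
    ty      : Carrier → Ty σ
    wt      : Carrier → ℕ

open Derivations

-- The unfoldings of fix x.t: a node derives t and has one child for every use of x.
module _ {Γ : Vec PCFType n} (D : Derivations (σ ∷ Γ) σ) where

  mutual
    data Tree : Ty σ → Set where
      node : ∀ m → Trees (ctx D m zero) → Tree (ty D m)

    data Trees : List (Ty σ) → Set where
      []  : Trees []
      _∷_ : ∀ {s′ l} → Tree s′ → Trees l → Trees (s′ ∷ l)

module _ {Γ : Vec PCFType n} {D : Derivations (σ ∷ Γ) σ} where

  mutual
    nodes : ∀ {s′} → Tree D s′ → List (Carrier D)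
    nodes (node m Ts) = m ∷ nodes* Ts

    nodes* : ∀ {l} → Trees D l → List (Carrier D)
    nodes* []       = []
    nodes* (T ∷ Ts) = nodes T ++ nodes* Ts

-- The PCF derivation fixes the rules; an element of the carrier supplies only the choices left
-- open. A family can thus vary these choices under one syntactic typing. The weights copy those of
-- the dℓPCF rules.
⟦_⟧ : ∀ {Γ : Vec PCFType n} {t} → Γ ⊢ t ∶ σ → Derivations Γ σ
⟦_⟧ {Γ = Γ} (var x) = record
  { Carrier = Ty (lookup Γ x) ; ctx = once Γ x ; ty = id ; wt = λ _ → 0 }
⟦ lit k ⟧ = record
  { Carrier = ⊤ ; ctx = λ _ _ → [] ; ty = λ _ → nat k ; wt = λ _ → 0 }
⟦ s d ⟧ = record
  { Carrier = Carrier ⟦ d ⟧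
  ; ctx     = ctx ⟦ d ⟧
  ; ty      = λ m → mapNat suc (ty ⟦ d ⟧ m)
  ; wt      = wt ⟦ d ⟧
  }
⟦ p d ⟧ = record
  { Carrier = Carrier ⟦ d ⟧
  ; ctx     = ctx ⟦ d ⟧
  ; ty      = λ m → mapNat (_∸ 1) (ty ⟦ d ⟧ m)
  ; wt      = wt ⟦ d ⟧
  }
⟦ ƛ d ⟧ = record
  { Carrier = Carrier ⟦ d ⟧
  ; ctx     = λ m x → ctx ⟦ d ⟧ m (suc x)
  ; ty      = λ m → ctx ⟦ d ⟧ m zero ↣ ty ⟦ d ⟧ m
  ; wt      = wt ⟦ d ⟧
  }
⟦ d ∙ e ⟧ = record
  { Carrier = Σ (Carrier ⟦ d ⟧) λ m → Σ (List (Carrier ⟦ e ⟧)) λ as →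
                map (ty ⟦ e ⟧) as ≡ dom (ty ⟦ d ⟧ m)
  ; ctx     = λ (m , as , _) x → ctx ⟦ d ⟧ m x ++ concat (map (λ a → ctx ⟦ e ⟧ a x) as)
  ; ty      = λ (m , _) → cod (ty ⟦ d ⟧ m)
  -- `length as` is the summand `I` of rule `A`: one unit per use of the argument.
  ; wt      = λ (m , as , _) → wt ⟦ d ⟧ m + length as + Σ⟨ map (wt ⟦ e ⟧) as ⟩
  }
⟦ ifz d then e₀ else e₁ ⟧ = record
  -- Only the executed branch has a derivation; the evidence about the scrutinee later refutes the
  -- constraint of the other branch.
  { Carrier = Σ (Carrier ⟦ d ⟧) λ m →
                (value (ty ⟦ d ⟧ m) ≡ 0 × Carrier ⟦ e₀ ⟧) ⊎
                (1 ≤ value (ty ⟦ d ⟧ m) × Carrier ⟦ e₁ ⟧)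
  ; ctx     = λ (m , a) x → ctx ⟦ d ⟧ m x ++
                [ (λ (_ , a₀) → ctx ⟦ e₀ ⟧ a₀ x) , (λ (_ , a₁) → ctx ⟦ e₁ ⟧ a₁ x) ]′ a
  ; ty      = λ (m , a) → [ ty ⟦ e₀ ⟧ ∘ proj₂ , ty ⟦ e₁ ⟧ ∘ proj₂ ]′ a
  ; wt      = λ (m , a) → wt ⟦ d ⟧ m + [ wt ⟦ e₀ ⟧ ∘ proj₂ , wt ⟦ e₁ ⟧ ∘ proj₂ ]′ a
  }
⟦ fix d ⟧ = record
  { Carrier = ∃ (Tree ⟦ d ⟧)
  ; ctx     = λ (_ , T) x → concat (map (λ m → ctx ⟦ d ⟧ m (suc x)) (nodes T))
  ; ty      = proj₁
  -- The root is not reached through the recursion variable, so it is not counted; this is the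
  -- `M ∸ 1` of rule `R`.
  ; wt      = λ (_ , T) → (length (nodes T) ∸ 1) + Σ⟨ map (wt ⟦ d ⟧) (nodes T) ⟩
  }

-- The abstract machine

mutual
  data Typed : Closure → PCFType → Set where
    ⟨_∥_⟩ : ∀ {Γ : Vec PCFType n} {t ρ} → Γ ⊢ t ∶ σ → TypedEnv ρ Γ → Typed ⟨ t ∥ ρ ⟩ σ

  data TypedEnv : Env n → Vec PCFType n → Set where
    []  : TypedEnv [] []
    _∷_ : ∀ {c} {ρ : Env n} {Γ} → Typed c σ → TypedEnv ρ Γ → TypedEnv (c ∷ ρ) (σ ∷ Γ)

data TypedStack : List Frame → PCFType → Set where
  []  : TypedStack [] Nat
  arg : ∀ {c ξ} → Typed c σ → TypedStack ξ τ → TypedStack (arg c ∷ ξ) (σ ⇒ τ)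
  s   : ∀ {ξ} → TypedStack ξ Nat → TypedStack (s ∷ ξ) Nat
  p   : ∀ {ξ} → TypedStack ξ Nat → TypedStack (p ∷ ξ) Nat
  ifz : ∀ {Γ : Vec PCFType n} {t u ρ ξ} → Γ ⊢ t ∶ σ → Γ ⊢ u ∶ σ → TypedEnv ρ Γ →
        TypedStack ξ σ → TypedStack (ifz t u ρ ∷ ξ) Nat

typed-lookup : ∀ {ρ : Env n} {Γ} → TypedEnv ρ Γ → ∀ x → Typed (lookup ρ x) (lookup Γ x)
typed-lookup (c ∷ ρ) zero    = c
typed-lookup (c ∷ ρ) (suc x) = typed-lookup ρ x

-- Intersection types of closures, environments and stacks.  The last argument is
-- a weight; every use of a closure in an environment or a stack adds one to it.
mutual
  data HasTy : ∀ {c} → Typed c σ → Ty σ → ℕ → Set where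
    clo : ∀ {Γ : Vec PCFType n} {t ρ} {d : Γ ⊢ t ∶ σ} {ρ′ : TypedEnv ρ Γ} m {s′ k} →
          ty ⟦ d ⟧ m ≡ s′ → HasUses ρ′ (ctx ⟦ d ⟧ m) k → HasTy ⟨ d ∥ ρ′ ⟩ s′ (wt ⟦ d ⟧ m + k)

  data HasTys {c} (c′ : Typed c σ) : List (Ty σ) → ℕ → Set where
    []  : HasTys c′ [] 0
    _∷_ : ∀ {s′ l k k′} → HasTy c′ s′ k → HasTys c′ l k′ → HasTys c′ (s′ ∷ l) (suc k + k′)

  data HasUses : ∀ {ρ : Env n} {Γ} → TypedEnv ρ Γ → Uses Γ → ℕ → Set where
    []  : ∀ {G} → HasUses [] G 0
    _∷_ : ∀ {c} {ρ : Env n} {Γ} {c′ : Typed c σ} {ρ′ : TypedEnv ρ Γ} {G k k′} →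
          HasTys c′ (G zero) k → HasUses ρ′ (λ x → G (suc x)) k′ →
          HasUses (c′ ∷ ρ′) G (k + k′)

-- The type is what the stack demands of the term in front of it for the run to end in `r`. In a
-- conditional frame only the selected branch is typed.
data Yields (r : ℕ) : ∀ {ξ} → TypedStack ξ σ → Ty σ → ℕ → Set where
  []   : Yields r [] (nat r) 0
  arg  : ∀ {c ξ} {c′ : Typed c σ} {ξ′ : TypedStack ξ τ} {l s′ k k′} →
         HasTys c′ l k → Yields r ξ′ s′ k′ → Yields r (arg c′ ξ′) (l ↣ s′) (k + k′)
  s    : ∀ {ξ} {ξ′ : TypedStack ξ Nat} {j k} →
         Yields r ξ′ (nat (suc j)) k → Yields r (s ξ′) (nat j) k
  p    : ∀ {ξ} {ξ′ : TypedStack ξ Nat} {j k} →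
         Yields r ξ′ (nat (j ∸ 1)) k → Yields r (p ξ′) (nat j) k
  ifz₀ : ∀ {Γ : Vec PCFType n} {t u ρ ξ} {d : Γ ⊢ t ∶ σ} {e : Γ ⊢ u ∶ σ}
           {ρ′ : TypedEnv ρ Γ} {ξ′ : TypedStack ξ σ} {s′ k k′} →
         HasTy ⟨ d ∥ ρ′ ⟩ s′ k → Yields r ξ′ s′ k′ → Yields r (ifz d e ρ′ ξ′) (nat 0) (k + k′)
  ifz₁ : ∀ {Γ : Vec PCFType n} {t u ρ ξ} {d : Γ ⊢ t ∶ σ} {e : Γ ⊢ u ∶ σ}
           {ρ′ : TypedEnv ρ Γ} {ξ′ : TypedStack ξ σ} {s′ j k k′} →
         HasTy ⟨ e ∥ ρ′ ⟩ s′ k → Yields r ξ′ s′ k′ →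
         Yields r (ifz d e ρ′ ξ′) (nat (suc j)) (k + k′)

-- Contexts are functions; this takes the place of function extensionality.
uses-cong : ∀ {ρ : Env n} {Γ} {ρ′ : TypedEnv ρ Γ} {G H k} → (∀ x → G x ≡ H x) →
            HasUses ρ′ G k → HasUses ρ′ H k
uses-cong eq []       = []
uses-cong eq (c ∷ ρ) = subst (λ l → HasTys _ l _) (eq zero) c ∷ uses-cong (eq ∘ suc) ρ

no-uses : ∀ {ρ : Env n} {Γ} (ρ′ : TypedEnv ρ Γ) → HasUses ρ′ (λ _ → []) 0
no-uses []       = []
no-uses (c ∷ ρ) = [] ∷ no-uses ρ

-- The successor in the weight is what the machine step looking up `x` pays for.
one-use : ∀ {ρ : Env n} {Γ} (ρ′ : TypedEnv ρ Γ) x {s′ k} →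
          HasTy (typed-lookup ρ′ x) s′ k → HasUses ρ′ (once Γ x s′) (suc k)
one-use (c ∷ ρ) zero    h =
  subst (HasUses _ _) (trans (+-identityʳ _) (+-identityʳ _)) ((h ∷ []) ∷ no-uses ρ)
one-use (c ∷ ρ) (suc x) h = [] ∷ one-use ρ x h

tys-++ : ∀ {c} {c′ : Typed c σ} {l l′ k k′} →
         HasTys c′ l k → HasTys c′ l′ k′ → HasTys c′ (l ++ l′) (k + k′)
tys-++ []                 h′ = h′
tys-++ (_∷_ {k = k} h hs) h′ = subst (HasTys _ _) (sym (+-assoc (suc k) _ _)) (h ∷ tys-++ hs h′)

uses-++ : ∀ {ρ : Env n} {Γ} {ρ′ : TypedEnv ρ Γ} {G H k k′} →
          HasUses ρ′ G k → HasUses ρ′ H k′ → HasUses ρ′ (λ x → G x ++ H x) (k + k′)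
uses-++ []       []         = []
uses-++ (_∷_ {k = i} {k′ = j} c ρ) (_∷_ {k = i′} {k′ = j′} c′ ρ′) =
  subst (HasUses _ _) (+-exchange i i′ j j′) (tys-++ c c′ ∷ uses-++ ρ ρ′)
  where
  +-exchange : ∀ a b c d → (a + b) + (c + d) ≡ (a + c) + (b + d)
  +-exchange = solve-∀

-- A closure with the types `l` amounts to a list of derivations of its term whose demands on the
-- environment are pooled. Apart from `k′`, the weight is what `⟦ d ∙ e ⟧` adds for its argument.
split-tys : ∀ {Γ : Vec PCFType n} {t ρ} {d : Γ ⊢ t ∶ σ} {ρ′ : TypedEnv ρ Γ} {l k} →
            HasTys ⟨ d ∥ ρ′ ⟩ l k →
            Σ (List (Carrier ⟦ d ⟧)) λ ms → map (ty ⟦ d ⟧) ms ≡ l × ∃ λ k′ →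
            HasUses ρ′ (λ x → concat (map (λ m → ctx ⟦ d ⟧ m x) ms)) k′ ×
            k ≡ (length ms + Σ⟨ map (wt ⟦ d ⟧) ms ⟩) + k′
split-tys {ρ′ = ρ′} [] = [] , refl , 0 , no-uses ρ′ , refl
split-tys {d = d} (clo m {k = j} refl h ∷ hs) with split-tys hs
... | ms , refl , k′ , h′ , refl =
  m ∷ ms , refl , j + k′ , uses-++ h h′ , eq (wt ⟦ d ⟧ m) j (length ms) _ k′
  where
  eq : ∀ w j l S k′ → suc (w + j) + ((l + S) + k′) ≡ (suc l + (w + S)) + (j + k′)
  eq = solve-∀

-- Besides the weights of its nodes, a tree costs its number of nodes minus one; the use of its root
-- adds the missing unit, so the truncated subtraction disappears.
gather-trees : ∀ {Γ : Vec PCFType n} {t ρ} {d : σ ∷ Γ ⊢ t ∶ σ} {ρ′ : TypedEnv ρ Γ} {l k} →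
               HasTys ⟨ fix d ∥ ρ′ ⟩ l k →
               Σ (Trees ⟦ d ⟧ l) λ Ts → ∃ λ k′ →
               HasUses ρ′ (λ x → concat (map (λ m → ctx ⟦ d ⟧ m (suc x)) (nodes* Ts))) k′ ×
               k ≡ (length (nodes* Ts) + Σ⟨ map (wt ⟦ d ⟧) (nodes* Ts) ⟩) + k′
gather-trees {ρ′ = ρ′} [] = [] , 0 , no-uses ρ′ , refl
gather-trees {d = d} (clo (_ , T@(node m Us)) {k = j} refl h ∷ hs) with gather-trees hs
... | Ts , k′ , h′ , refl =
  T ∷ Ts , j + k′ ,
  uses-cong (λ x → concat-map-++ _ (nodes T) (nodes* Ts)) (uses-++ h h′) ,
  trans (eq (length (nodes* Us)) _ j (length (nodes* Ts)) _ k′)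
        (cong (_+ (j + k′)) (sym (cong₂ _+_ (length-++ (nodes T)) (Σ-map-++ (wt ⟦ d ⟧) (nodes T) _))))
  where
  eq : ∀ a S j b S′ k′ →
       suc ((a + S) + j) + ((b + S′) + k′) ≡ ((suc a + b) + (S + S′)) + (j + k′)
  eq = solve-∀

Reaches : ∀ {c ξ} → Typed c σ → TypedStack ξ σ → ℕ → ℕ → Set
Reaches c′ ξ′ r j = ∃ λ s′ → ∃₂ λ k k′ → HasTy c′ s′ k × Yields r ξ′ s′ k′ × k + k′ ≤ j

reaches-var : ∀ {Γ : Vec PCFType n} {ρ} (ρ′ : TypedEnv ρ Γ) x {ξ r j} {ξ′ : TypedStack ξ _} →
              Reaches (typed-lookup ρ′ x) ξ′ r j →
              Reaches {c = ⟨ var x ∥ ρ ⟩} ⟨ var x ∥ ρ′ ⟩ ξ′ r (suc j)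
reaches-var ρ′ x (_ , _ , _ , h , y , le) = _ , _ , _ , clo _ refl (one-use ρ′ x h) , y , s≤s le

-- Subject expansion along a run; only the lookup of a variable costs weight.
mutual
  expand : ∀ {Γ : Vec PCFType n} {t ρ ξ r j k} {μ : Env k} (d : Γ ⊢ t ∶ σ)
           (ρ′ : TypedEnv ρ Γ) (ξ′ : TypedStack ξ σ) →
           ⟨ t ∥ ρ ∥ ξ ⟩ ⟶[ j ] ⟨ lit r ∥ μ ∥ [] ⟩ → Reaches ⟨ d ∥ ρ′ ⟩ ξ′ r j
  expand (lit r) ρ′ [] done = _ , _ , _ , clo tt refl (no-uses ρ′) , [] , z≤n
  expand (d ∙ e) ρ′ ξ′ (step app run) with expand d ρ′ (arg ⟨ e ∥ ρ′ ⟩ ξ′) run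
  ... | _ , _ , _ , clo m {k = j} eq h , arg {k′ = k′} hs y , le with split-tys hs
  ... | as , eqs , i , h′ , refl =
    _ , _ , _ , clo (m , as , trans eqs (cong dom (sym eq))) (cong cod eq) (uses-++ h h′) , y ,
    m≤n⇒m≤1+n (≤-trans (≤-reflexive (regroup (wt ⟦ d ⟧ m) (length as) _ j i k′)) le)
    where
    regroup : ∀ w l S j i k′ →
              ((w + l + S) + (j + i)) + k′ ≡ (w + j) + (((l + S) + i) + k′)
    regroup = solve-∀
  -- The uses of the bound variable move from the environment to the stack with their weight
  -- unchanged.
  expand (ƛ d) ρ′ (arg c′ ξ′) (step lam run) with expand d (c′ ∷ ρ′) ξ′ run
  ... | _ , _ , _ , clo m {k = _} refl (_∷_ {k = i} {k′ = j} hs h) , y , le =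
    _ , _ , _ , clo m refl h , arg hs y ,
    m≤n⇒m≤1+n (≤-trans (≤-reflexive (regroup (wt ⟦ d ⟧ m) i j _)) le)
    where
    regroup : ∀ w i j k′ → (w + j) + (i + k′) ≡ (w + (i + j)) + k′
    regroup = solve-∀
  expand (var x) ρ′ ξ′ (step (var eq) run) =
    reaches-var ρ′ x (expand-closure (typed-lookup ρ′ x) eq ξ′ run)
  expand (ifz d then e₀ else e₁) ρ′ ξ′ (step ifz run) with expand d ρ′ (ifz e₀ e₁ ρ′ ξ′) run
  ... | _ , _ , _ , clo m {k = j} eq h , ifz₀ {k′ = k′} (clo a {k = i} refl h′) y , le =
    _ , _ , _ , clo (m , inj₁ (cong value eq , a)) refl (uses-++ h h′) , y ,
    m≤n⇒m≤1+n (≤-trans (≤-reflexive (regroup-ifz (wt ⟦ d ⟧ m) (wt ⟦ e₀ ⟧ a) j i k′)) le)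
  ... | _ , _ , _ , clo m {k = j} eq h , ifz₁ {k′ = k′} (clo a {k = i} refl h′) y , le =
    _ , _ , _ ,
    clo (m , inj₂ (subst (1 ≤_) (sym (cong value eq)) (s≤s z≤n) , a)) refl (uses-++ h h′) , y ,
    m≤n⇒m≤1+n (≤-trans (≤-reflexive (regroup-ifz (wt ⟦ d ⟧ m) (wt ⟦ e₁ ⟧ a) j i k′)) le)
  expand (fix d) ρ′ ξ′ (step fix run) with expand d (⟨ fix d ∥ ρ′ ⟩ ∷ ρ′) ξ′ run
  ... | _ , _ , k′ , clo m refl (_∷_ {k′ = j} hs h) , y , le with gather-trees hs
  ... | Ts , i , h′ , refl =
    -- The uses of the recursion variable become the subtrees. Their roots have been charged as
    -- uses; the new root is free.
    _ , _ , _ , clo (_ , node m Ts) refl (uses-++ h h′) , y ,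
    m≤n⇒m≤1+n (≤-trans (≤-reflexive (regroup (wt ⟦ d ⟧ m) (length (nodes* Ts)) _ j i k′)) le)
    where
    regroup : ∀ w l S j i k′ → ((l + (w + S)) + (j + i)) + k′ ≡ (w + (((l + S) + i) + j)) + k′
    regroup = solve-∀
  expand (s d) ρ′ ξ′ (step s run) with expand d ρ′ (s ξ′) run
  ... | _ , _ , _ , clo m eq h , s y , le =
    _ , _ , _ , clo m (cong (mapNat suc) eq) h , y , m≤n⇒m≤1+n le
  expand (p d) ρ′ ξ′ (step p run) with expand d ρ′ (p ξ′) run
  ... | _ , _ , _ , clo m eq h , p y , le =
    _ , _ , _ , clo m (cong (mapNat (_∸ 1)) eq) h , y , m≤n⇒m≤1+n le
  expand (lit k) ρ′ (s ξ′) (step lit-s run) with expand (lit (suc k)) ρ′ ξ′ run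
  ... | _ , _ , _ , clo _ refl h , y , le = _ , _ , _ , clo tt refl h , s y , m≤n⇒m≤1+n le
  expand (lit k) ρ′ (p ξ′) (step lit-p run) with expand (lit (k ∸ 1)) ρ′ ξ′ run
  ... | _ , _ , _ , clo _ refl h , y , le = _ , _ , _ , clo tt refl h , p y , m≤n⇒m≤1+n le
  expand (lit _) ρ′ (ifz d e μ′ ξ′) (step lit-zero run) with expand d μ′ ξ′ run
  ... | _ , _ , _ , h , y , le =
    _ , _ , _ , clo tt refl (no-uses ρ′) , ifz₀ h y , m≤n⇒m≤1+n le
  expand (lit _) ρ′ (ifz d e μ′ ξ′) (step lit-suc run) with expand e μ′ ξ′ run
  ... | _ , _ , _ , h , y , le =
    _ , _ , _ , clo tt refl (no-uses ρ′) , ifz₁ h y , m≤n⇒m≤1+n le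

  -- The looked-up closure is generalised to `c`, so that matching on the equation of the lookup
  -- step exposes its PCF derivation.
  expand-closure : ∀ {c t} {ρ : Env n} {ξ r j k} {μ : Env k} (c′ : Typed c σ) → c ≡ ⟨ t ∥ ρ ⟩ →
                   (ξ′ : TypedStack ξ σ) → ⟨ t ∥ ρ ∥ ξ ⟩ ⟶[ j ] ⟨ lit r ∥ μ ∥ [] ⟩ →
                   Reaches c′ ξ′ r j
  expand-closure ⟨ d ∥ ρ′ ⟩ refl ξ′ run = expand d ρ′ ξ′ run

  regroup-ifz : ∀ w w′ j i k′ → ((w + w′) + (j + i)) + k′ ≡ (w + j) + ((w′ + i) + k′)
  regroup-ifz = solve-∀

-- Families of intersection types

module Conversion (E : Program) (determined : Determined E) where

  open Evaluation E
  open Instances E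
  open Determined determined using (functional)

  mutual
    -- A true constraint comes with values of its own, which must agree with those of the family.
    ⇓-functional : ∀ {ρ : Vec ℕ φ} {I v w} → E ∣ ρ ⊢ I ⇓ v → E ∣ ρ ⊢ I ⇓ w → v ≡ w
    ⇓-functional (var i) (var .i) = refl
    ⇓-functional (app {f = f} vs e) (app ws e′) with ⇓*-functional vs ws
    ... | refl = functional f e e′
    ⇓-functional (sum e es) (sum e′ es′) with ⇓-functional e e′
    ... | refl = Sum-functional es es′
    ⇓-functional (forest e₁ e₂ es) (forest e₁′ e₂′ es′)
      with ⇓-functional e₁ e₁′ | ⇓-functional e₂ e₂′
    ... | refl | refl = Forest-functional es es′

    ⇓*-functional : ∀ {ρ : Vec ℕ φ} {k} {Is : Vec _ k} {vs ws} →
                    Pointwise (E ∣ ρ ⊢_⇓_) Is vs → Pointwise (E ∣ ρ ⊢_⇓_) Is ws → vs ≡ ws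
    ⇓*-functional []       []         = refl
    ⇓*-functional (e ∷ es) (e′ ∷ es′) = cong₂ _∷_ (⇓-functional e e′) (⇓*-functional es es′)

    Sum-functional : ∀ {ρ : Vec ℕ φ} {J k v w} → Sum E ρ J k v → Sum E ρ J k w → v ≡ w
    Sum-functional zero       zero         = refl
    Sum-functional (suc es e) (suc es′ e′) =
      cong₂ _+_ (Sum-functional es es′) (⇓-functional e e′)

    Forest-functional : ∀ {ρ : Vec ℕ φ} {K i j v w} →
                        Forest E ρ K i j v → Forest E ρ K i j w → v ≡ w
    Forest-functional zero zero = refl
    Forest-functional (suc es e fs) (suc es′ e′ fs′) with Forest-functional es es′
    ... | refl with ⇓-functional e e′
    ... | refl = cong (_ +_) (Forest-functional fs fs′)

  Models : Constraints (sig E) φ → Vec ℕ φ → Set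
  Models Φ ρ = All (True E ρ) Φ

  ,<-elim : ∀ {Φ : Constraints (sig E) φ} {I i ρ} → Models (Φ ,< I) (i ∷ ρ) →
            Models Φ ρ × ∃ λ v → (E ∣ ρ ⊢ I ⇓ v) × i < v
  ,<-elim {I = I} {i} ((v , w , e , e′ , v≤w) ∷ ts) =
    All.map unwk-True (map⁻ ts) ,
    w , unwk-⇓ I e′ , subst (_≤ w) (trans (⇓-functional e (+-⇓ (var zero) 𝟏-⇓)) (+-comm i 1)) v≤w
    where
    unwk-True : ∀ {C} → True E (i ∷ _) (wkᶜ C) → True E _ C
    unwk-True {I ≼ J} (v , w , e , e′ , v≤w) = v , w , unwk-⇓ I e , unwk-⇓ J e′ , v≤w

  ,<-intro : ∀ {Φ : Constraints (sig E) φ} {I i v ρ} → Models Φ ρ → E ∣ ρ ⊢ I ⇓ v → i < v →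
             Models (Φ ,< I) (i ∷ ρ)
  ,<-intro {i = i} {v} ts e i<v =
    (_ , _ , +-⇓ (var zero) 𝟏-⇓ , wk-⇓ e , subst (_≤ v) (+-comm 1 i) i<v) ∷
    map⁺ (All.map wk-True ts)
    where
    wk-True : ∀ {C} → True E _ C → True E (i ∷ _) (wkᶜ C)
    wk-True {I ≼ J} (v , w , e , e′ , v≤w) = v , w , wk-⇓ e , wk-⇓ e′ , v≤w

  mutual
    -- A common instance gives the inequalities in both directions, so the hypothesis is symmetric
    -- and survives the contravariant position.
    ⊑-intro : ∀ {Φ : Constraints (sig E) φ} {a b} → Shape a σ → Shape b σ →
              (∀ {ρ} → Models Φ ρ → ∃ λ (s′ : Ty σ) → ρ ⊩ a ∋ s′ × ρ ⊩ b ∋ s′) →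
              E ∣ Φ ⊢ a ⊑ b
    ⊑-intro {Φ = Φ} {a = Nat[ I ⋯ J ]} {b = Nat[ K ⋯ H ]} nat nat h = nat left right
      where
      left : E ∣ Φ ⊨ K ≼ I
      left ρ ts with h ts
      ... | _ , nat e _ , nat e′ _ = _ , _ , e′ , e , ≤-refl
      right : E ∣ Φ ⊨ J ≼ H
      right ρ ts with h ts
      ... | _ , nat _ e , nat _ e′ = _ , _ , e , e′ , ≤-refl
    ⊑-intro {Φ = Φ} {a = a₁ ⊸ a₂} {b = b₁ ⊸ b₂} (fun a₁-shape a₂-shape) (fun b₁-shape b₂-shape) h =
      fun (⊑ᵐ-intro b₁-shape a₁-shape left) (⊑-intro a₂-shape b₂-shape right)
      where
      left : ∀ {ρ} → Models Φ ρ → ∃ λ l → ρ ⊩ᵐ b₁ ∋ l × ρ ⊩ᵐ a₁ ∋ l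
      left ts with h ts
      ... | _ , fun a _ , fun b _ = _ , b , a
      right : ∀ {ρ} → Models Φ ρ → ∃ λ s′ → ρ ⊩ a₂ ∋ s′ × ρ ⊩ b₂ ∋ s′
      right ts with h ts
      ... | _ , fun _ a , fun _ b = _ , a , b

    ⊑ᵐ-intro : ∀ {Φ : Constraints (sig E) φ} {a b} → Shapeᵐ a σ → Shapeᵐ b σ →
               (∀ {ρ} → Models Φ ρ → ∃ λ (l : List (Ty σ)) → ρ ⊩ᵐ a ∋ l × ρ ⊩ᵐ b ∋ l) →
               E ∣ Φ ⊢ a ⊑ᵐ b
    ⊑ᵐ-intro {Φ = Φ} {[< I ]· a} {[< J ]· b} (mod a-shape) (mod b-shape) h =
      mod (⊑-intro a-shape b-shape body) bound
      where
      body : ∀ {ρ} → Models (Φ ,< I) ρ → ∃ λ s′ → ρ ⊩ a ∋ s′ × ρ ⊩ b ∋ s′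
      body {i ∷ ρ} ts with ,<-elim {I = I} ts
      ... | ts′ , v , e , i<v with h ts′
      ... | l , mod e′ as , mod _ bs with nth-< l (subst (i <_) (⇓-functional e e′) i<v)
      ... | s′ , eq = s′ , as i eq , bs i eq
      bound : E ∣ Φ ⊨ J ≼ I
      bound ρ ts with h ts
      ... | _ , mod e _ , mod e′ _ = _ , _ , e′ , e , ≤-refl

  -- The bound leaves finitely many models of Φ, so that the values of a family fit in
  -- a table.
  record Family (Φ : Constraints (sig E) φ) (X : Set) : Set where
    field
      at      : Vec ℕ φ → Maybe X
      defined : ∀ {ρ} → Models Φ ρ → ∃ λ c → at ρ ≡ just c
      bound   : ℕ
      bounds  : ∀ {ρ} → Models Φ ρ → Vec.All (_< bound) ρ

  open Family

  infix 4 _∋_↦_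

  record _∋_↦_ {Φ : Constraints (sig E) φ} (f : Family Φ X) (ρ : Vec ℕ φ) (c : X) : Set where
    constructor _,_
    field
      models : Models Φ ρ
      at≡    : at f ρ ≡ just c

  Denotes : {Φ : Constraints (sig E) φ} → Family Φ X → Index (sig E) φ → (X → ℕ) → Set
  Denotes f I h = ∀ {ρ c} → f ∋ ρ ↦ c → E ∣ ρ ⊢ I ⇓ h c

  module _ {Φ : Constraints (sig E) φ} (f : Family Φ X) where

    value-at : ∀ {ρ} → Models Φ ρ → ∃ λ c → f ∋ ρ ↦ c
    value-at ts with defined f ts
    ... | c , eq = c , (ts , eq)

    represent : (h : X → ℕ) → ∃ λ I → Denotes f I h
    represent h = table (bound f) (Maybe.maybe′ h 0 ∘ at f) , λ (ts , eq) →
      ⇓-≡ (cong (Maybe.maybe′ h 0) eq) (table-⇓ (bound f) _ (bounds f ts))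

    representᵇ : (h : X → Ty σ) →
                 ∃ λ a → Shape a σ × (∀ {ρ c} → f ∋ ρ ↦ c → ρ ⊩ a ∋ h c)
    representᵇ h with reify (bound f) (Maybe.map h ∘ at f)
    ... | a , a-shape , ok = a , a-shape , λ (ts , eq) → ok (bounds f ts) (cong (Maybe.map h) eq)

    -- Only the body is kept: the callers put it under bounds of their own, for instance that of a
    -- prefix.
    represent* : (h : X → List (Ty σ)) →
                 ∃ λ a → Shape a σ × (∀ {ρ c} → f ∋ ρ ↦ c → Entries ρ a (h c))
    represent* h with reifyᵐ (bound f) (Maybe.map h ∘ at f)
    ... | [< I ]· a , mod a-shape , ok = a , a-shape ,
      λ (ts , eq) → entries (ok (bounds f ts) (cong (Maybe.map h) eq))
      where
      entries : ∀ {ρ l} → ρ ⊩ᵐ [< I ]· a ∋ l → Entries ρ a l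
      entries (mod _ as) = as

    ⊑-family : ∀ {a b} (h : X → Ty σ) → Shape a σ → Shape b σ →
               (∀ {ρ c} → f ∋ ρ ↦ c → ρ ⊩ a ∋ h c) → (∀ {ρ c} → f ∋ ρ ↦ c → ρ ⊩ b ∋ h c) →
               E ∣ Φ ⊢ a ⊑ b
    ⊑-family h a-shape b-shape ha hb = ⊑-intro a-shape b-shape λ ts →
      h (proj₁ (value-at ts)) , ha (proj₂ (value-at ts)) , hb (proj₂ (value-at ts))

    ⊑ᶜ-family : ∀ {Γ : Vec PCFType n} (As Bs : Ctx (sig E) φ n) (h : X → Uses Γ) →
                (∀ x → Shapeᵐ (lookup As x) (lookup Γ x)) →
                (∀ x → Shapeᵐ (lookup Bs x) (lookup Γ x)) →
                (∀ x {ρ c} → f ∋ ρ ↦ c → ρ ⊩ᵐ lookup As x ∋ h c x) →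
                (∀ x {ρ c} → f ∋ ρ ↦ c → ρ ⊩ᵐ lookup Bs x ∋ h c x) →
                E ∣ Φ ⊢ As ⊑ᶜ Bs
    ⊑ᶜ-family As Bs h As-shape Bs-shape hA hB x = ⊑ᵐ-intro (As-shape x) (Bs-shape x) λ ts →
      h (proj₁ (value-at ts)) x , hA x (proj₂ (value-at ts)) , hB x (proj₂ (value-at ts))

    ≼-family : ∀ {I J} (g h : X → ℕ) → Denotes f I g → Denotes f J h →
               (∀ c → g c ≤ h c) → E ∣ Φ ⊨ I ≼ J
    ≼-family g h eI eJ le ρ ts =
      _ , _ , eI (proj₂ (value-at ts)) , eJ (proj₂ (value-at ts)) , le (proj₁ (value-at ts))

    module _ (C : Constraint (sig E) φ) (g : X → Maybe Y)
             (total : ∀ {ρ c} → f ∋ ρ ↦ c → True E ρ C → ∃ λ y → g c ≡ just y) where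

      -- This serves the branches of `ifz`: `total` says that where `C` is true the derivation has
      -- taken the branch in question.
      refine : Family (C ∷ Φ) Y
      refine = record
        { at      = λ ρ → at f ρ >>= g
        ; defined = λ { (t ∷ ts) → let c , c-at = value-at ts ; y , eq = total c-at t in
                        y , trans (cong (_>>= g) (_∋_↦_.at≡ c-at)) eq }
        ; bound   = bound f
        ; bounds  = λ { (_ ∷ ts) → bounds f ts }
        }

      refine⁻ : ∀ {ρ y} → refine ∋ ρ ↦ y → ∃ λ c → f ∋ ρ ↦ c × g c ≡ just y
      refine⁻ {ρ} ((_ ∷ ts) , eq) with >>=-just⁻ (at f ρ) g eq
      ... | c , eq′ , eq″ = c , (ts , eq′) , eq″

    mapᶠ : (X → Y) → Family Φ Y
    mapᶠ g = record
      { at      = Maybe.map g ∘ at f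
      ; defined = λ ts → g (proj₁ (defined f ts)) , cong (Maybe.map g) (proj₂ (defined f ts))
      ; bound   = bound f
      ; bounds  = bounds f
      }

    mapᶠ-elim : ∀ (g : X → Y) {Q : Y → Set} {ρ y} → mapᶠ g ∋ ρ ↦ y →
                (∀ {c} → f ∋ ρ ↦ c → Q (g c)) → Q y
    mapᶠ-elim g {ρ = ρ} (ts , eq) h with at f ρ in eq′ | eq
    ... | just c | refl = h (ts , eq′)

    module _ (ls : X → List Y) (I : Index (sig E) φ) (I-ok : Denotes f I (length ∘ ls)) where

      -- This serves premises below a new bound: the fresh variable is a position in the list
      -- attached to the outer assignment. The lists may be longer than the old bound, which is
      -- enlarged accordingly.
      select : Family (Φ ,< I) Y
      select = record
        { at      = λ { (i ∷ ρ) → at f ρ >>= λ c → nth (ls c) i }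
        ; defined = λ { {i ∷ ρ} ts → def ts }
        ; bound   = bound f ⊔ maximum (bound f) (Maybe.maybe′ (length ∘ ls) 0 ∘ at f)
        ; bounds  = λ { {i ∷ ρ} ts → bnd ts }
        }
        where
        len : ∀ {i ρ} → Models (Φ ,< I) (i ∷ ρ) → ∃ λ c → f ∋ ρ ↦ c × i < length (ls c)
        len {i} ts with ,<-elim {I = I} ts
        ... | ts′ , v , e , i<v with value-at ts′
        ... | c , c-at = c , c-at , subst (i <_) (⇓-functional e (I-ok c-at)) i<v

        def : ∀ {i ρ} → Models (Φ ,< I) (i ∷ ρ) → ∃ λ y → (at f ρ >>= λ c → nth (ls c) i) ≡ just y
        def {i} ts with len ts
        ... | c , (_ , eq) , i<len with nth-< (ls c) i<len
        ... | y , eq′ = y , trans (cong (_>>= λ c → nth (ls c) i) eq) eq′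

        bnd : ∀ {i ρ} → Models (Φ ,< I) (i ∷ ρ) → Vec.All (_< bound f ⊔ _) (i ∷ ρ)
        bnd {i} {ρ} ts with len ts
        ... | c , (ts′ , eq) , i<len =
          <-≤-trans i<len
            (≤-trans (≤-trans (≤-reflexive (sym (cong (Maybe.maybe′ (length ∘ ls) 0) eq)))
                              (≤-maximum (bound f) _ (bounds f ts′)))
                     (m≤n⊔m (bound f) _))
          Vec.∷ Vec.map (λ a<B → <-≤-trans a<B (m≤m⊔n (bound f) _)) (bounds f ts′)

      select⁻ : ∀ {i ρ y} → select ∋ i ∷ ρ ↦ y → ∃ λ c → f ∋ ρ ↦ c × nth (ls c) i ≡ just y
      select⁻ {i} {ρ} (ts , eq) with >>=-just⁻ (at f ρ) (λ c → nth (ls c) i) eq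
      ... | c , eq′ , eq″ = c , (proj₁ (,<-elim {I = I} ts) , eq′) , eq″

      select⁺ : ∀ {i ρ c y} → f ∋ ρ ↦ c → nth (ls c) i ≡ just y → select ∋ i ∷ ρ ↦ y
      select⁺ {i} {c = c} c-at@(ts , eq) eq′ =
        ,<-intro ts (I-ok c-at) (nth-just⇒< (ls c) i eq′) ,
        trans (cong (_>>= λ c → nth (ls c) i) eq) eq′

  ∑-concat-⇓ : ∀ {ρ : Vec ℕ φ} {I J} (xss : List (List X)) → E ∣ ρ ⊢ I ⇓ length xss →
               (∀ a {xs} → nth xss a ≡ just xs → E ∣ a ∷ ρ ⊢ J ⇓ length xs) →
               E ∣ ρ ⊢ ∑ I J ⇓ length (concat xss)
  ∑-concat-⇓ xss e h = ⇓-≡ (sym (length-concat xss)) (∑-⇓ length xss e h)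

  -- One body `a` for the concatenation serves both summands: the first reads its initial entries,
  -- the second reads it shifted by the length of `g`.
  split-⊎ : ∀ {ρ : Vec ℕ φ} {I J a} (g h : List (Ty σ)) →
            E ∣ ρ ⊢ I ⇓ length g → E ∣ ρ ⊢ J ⇓ length h → Entries ρ a (g ++ h) →
            ρ ⊩ᵐ [< I ]· a ∋ g ×
            Entries ρ (subᵇ ((wk I +ᵢ var zero) • (λ i → var (suc i))) a) h ×
            ρ ⊩ᵐ [< I +ᵢ J ]· a ∋ (g ++ h)
  split-⊎ {ρ = ρ} {I} {J} {a} g h eI eJ as =
    mod eI (λ i eq → as i (nth-++ˡ g i eq)) ,
    (λ i eq → sub-⊩ (values i) (as (length g + i) (trans (nth-++ʳ g i) eq))) ,
    mod (⇓-≡ (sym (length-++ g)) (+-⇓ eI eJ)) as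
    where
    values : ∀ i → Values ((wk I +ᵢ var zero) • (λ i → var (suc i))) ((length g + i) ∷ ρ) (i ∷ ρ)
    values i zero    = +-⇓ (wk-⇓ eI) (var zero)
    values i (suc j) = var (suc j)

  -- As for `⊎`, one body holds the concatenation; the `i`-th list reads it from the total length of
  -- the earlier lists on.
  split-∑ : ∀ {ρ : Vec ℕ φ} {J a} (xss : List (List (Ty σ))) →
            (∀ i {xs} → nth xss i ≡ just xs → E ∣ i ∷ ρ ⊢ J ⇓ length xs) →
            Entries ρ a (concat xss) →
            ∀ i {xs} → nth xss i ≡ just xs →
            (i ∷ ρ) ⊩ᵐ [< J ]· subᵇ ((∑ (var (suc zero)) (under₂ J) +ᵢ var zero)
                                       • (λ i → var (suc (suc i)))) a ∋ xs
  split-∑ {ρ = ρ} {J} {a} xss eJ as i eq =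
    mod (eJ i eq) λ j eq′ → sub-⊩ (values j) (as _ (nth-concat xss i eq eq′))
    where
    values : ∀ j → Values _ ((Σ⟨ map length (take i xss) ⟩ + j) ∷ ρ) (j ∷ i ∷ ρ)
    values j zero    =
      +-⇓ (sum (var (suc zero))
               (Sum-nth length xss (λ d eq′ → ren-⇓ (lift-Agree d λ _ → refl) (eJ d eq′)) i
                        (<⇒≤ (nth-just⇒< xss i eq))))
          (var zero)
    values j (suc k) = var (suc (suc k))

-- Pre-order enumeration of unfoldings

module _ {Γ : Vec PCFType n} {D : Derivations (σ ∷ Γ) σ} where

  root : ∀ {s′} (T : Tree D s′) → ∃ λ m → nth (nodes T) 0 ≡ just m × ty D m ≡ s′
  root (node m Ts) = m , refl , refl

  length-nodes : ∀ {s′} (T : Tree D s′) → length (nodes T) ≡ 1 + (length (nodes T) ∸ 1)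
  length-nodes (node m Ts) = refl

  mutual
    -- In pre-order the descendants of the node at `b` directly follow it, which is why rule `R`
    -- starts its forest of children at `b + 1`.
    children : ∀ {s′} (T : Tree D s′) b {m} → nth (nodes T) b ≡ just m →
               Σ (Trees D (ctx D m zero)) λ Us → Located (nodes T) (b + 1) (nodes* Us)
    children (node m Ts) zero    refl = Ts , λ i eq → eq
    children (node m Ts) (suc b) eq   with children* Ts b eq
    ... | Us , at = Us , at

    children* : ∀ {l} (Ts : Trees D l) b {m} → nth (nodes* Ts) b ≡ just m →
                Σ (Trees D (ctx D m zero)) λ Us → Located (nodes* Ts) (b + 1) (nodes* Us)
    children* (T ∷ Ts) b eq with nth-++⁻ (nodes T) b eq
    ... | inj₁ eq′ with children T b eq′
    ... | Us , at = Us , λ i eq″ → nth-++ˡ (nodes T) (b + 1 + i) (at i eq″)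
    children* (T ∷ Ts) b eq | inj₂ (b′ , refl , eq′) with children* Ts b′ eq′
    ... | Us , at = Us , λ i eq″ →
      trans (cong (nth (nodes T ++ nodes* Ts)) (regroup (length (nodes T)) b′ i))
            (trans (nth-++ʳ (nodes T) (b′ + 1 + i)) (at i eq″))
      where
      regroup : ∀ l b i → ((l + b) + 1) + i ≡ l + ((b + 1) + i)
      regroup = solve-∀

-- The nodes of a tree in pre-order unfold △: in a list of nodes, a segment that
-- enumerates the trees Ts from position o on is a forest starting at o.
module _ {E : Program} {Γ : Vec PCFType n} {D : Derivations (σ ∷ Γ) σ}
         {K : Index (sig E) (suc φ)} {ρ : Vec ℕ φ} (ms : List (Carrier D))
         (arities : ∀ i {m} → nth ms i ≡ just m → E ∣ i ∷ ρ ⊢ K ⇓ length (ctx D m zero)) where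

  mutual
    -- With `k` nodes before `T`, its root has number `o + k` and its subtrees start at `o + 1 + k`,
    -- as in the recursion of `Forest`.
    forest-step : ∀ {s′ l o j k} (T : Tree D s′) (Ts : Trees D l) →
                  Located ms (o + k) (nodes* (T ∷ Ts)) → Forest E ρ K o j k →
                  Forest E ρ K o (suc j) (k + 1 + (length (nodes T) ∸ 1)) ×
                  Located ms (o + (k + 1 + (length (nodes T) ∸ 1))) (nodes* Ts)
    forest-step {o = o} {k = k} (node m Us) Ts at fs =
      suc fs (arities (o + k) (trans (cong (nth ms) (sym (+-identityʳ _))) (at 0 refl)))
          (forest-of Us λ i eq →
            trans (cong (nth ms) (regroup o k i)) (at (suc i) (nth-++ˡ (nodes* Us) i eq))) ,
      λ i eq → trans (cong (nth ms) (regroup′ o k (length (nodes* Us)) i))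
                     (at (suc (length (nodes* Us) + i)) (trans (nth-++ʳ (nodes* Us) i) eq))
      where
      regroup : ∀ o k i → (o + 1 + k) + i ≡ (o + k) + suc i
      regroup = solve-∀
      regroup′ : ∀ o k l i → (o + (k + 1 + l)) + i ≡ (o + k) + suc (l + i)
      regroup′ = solve-∀

    -- `Forest` is extended by a last tree while `Trees` is consumed from the first, hence the
    -- accumulated forest of `j` trees and `k` nodes.
    forest-from : ∀ {l o j k} (Ts : Trees D l) → Located ms (o + k) (nodes* Ts) →
                  Forest E ρ K o j k → Forest E ρ K o (j + length l) (k + length (nodes* Ts))
    forest-from []       at fs = subst₂ (Forest E ρ K _) (sym (+-identityʳ _)) (sym (+-identityʳ _)) fs
    forest-from {l = _ ∷ l} {j = j} {k} (T ∷ Ts) at fs with forest-step T Ts at fs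
    ... | fs′ , at′ =
      subst₂ (Forest E ρ K _) (sym (+-suc j (length l))) sizes (forest-from Ts at′ fs′)
      where
      sizes : (k + 1 + (length (nodes T) ∸ 1)) + length (nodes* Ts) ≡
             k + length (nodes T ++ nodes* Ts)
      sizes = trans (cong (_+ length (nodes* Ts))
                          (trans (+-assoc k 1 _) (cong (k +_) (sym (length-nodes T)))))
                   (trans (+-assoc k _ _) (cong (k +_) (sym (length-++ (nodes T)))))

    forest-of : ∀ {l o} (Ts : Trees D l) → Located ms o (nodes* Ts) →
                Forest E ρ K o (length l) (length (nodes* Ts))
    forest-of {o = o} Ts at =
      forest-from Ts (subst (λ o → Located ms o (nodes* Ts)) (sym (+-identityʳ o)) at) zero

  -- A root follows all nodes of the trees before it, and their number `k′` is the cardinality of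
  -- that forest. Rule `R` names a child by this position.
  child-from : ∀ {l o j k a s′} (Ts : Trees D l) → Located ms (o + k) (nodes* Ts) →
               Forest E ρ K o j k → nth l a ≡ just s′ →
               ∃₂ λ k′ m → Forest E ρ K o (j + a) k′ × nth ms (o + k′) ≡ just m × ty D m ≡ s′
  child-from {o = o} {j} {k} {zero} (T ∷ Ts) at fs refl with root T
  ... | m , eq , ty≡ =
    k , m , subst (λ j → Forest E ρ K o j k) (sym (+-identityʳ j)) fs ,
    trans (cong (nth ms) (sym (+-identityʳ _))) (at 0 (nth-++ˡ (nodes T) 0 eq)) , ty≡
  child-from {o = o} {j} {a = suc a} (T ∷ Ts) at fs eq with forest-step T Ts at fs
  ... | fs′ , at′ with child-from {a = a} Ts at′ fs′ eq
  ... | k′ , m , fs″ , eq′ , ty≡ =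
    k′ , m , subst (λ j → Forest E ρ K o j k′) (sym (+-suc j a)) fs″ , eq′ , ty≡

-- From intersection types to dℓPCF

module Completeness (E : Program) (determined : Determined E) where

  open Evaluation E
  open Instances E
  open Conversion E determined
  open Family

  nat-instance : ∀ {ρ : Vec ℕ φ} {I J} s′ → E ∣ ρ ⊢ I ⇓ value s′ → E ∣ ρ ⊢ J ⇓ value s′ →
                 ρ ⊩ Nat[ I ⋯ J ] ∋ s′
  nat-instance (nat k) e e′ = nat e e′

  nat-instance⁻ : ∀ {ρ : Vec ℕ φ} {I J s′} → ρ ⊩ Nat[ I ⋯ J ] ∋ s′ →
                  (E ∣ ρ ⊢ I ⇓ value s′) × (E ∣ ρ ⊢ J ⇓ value s′)
  nat-instance⁻ (nat e e′) = e , e′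

  -- Values are prescribed, not the index terms themselves. This freedom lets a rule hand its
  -- premises types of the form that `⊎` and `∑` require.
  record Represents {Φ : Constraints (sig E) φ} {Γ : Vec PCFType n} (D : Derivations Γ σ)
                    (f : Family Φ (Carrier D)) (As : Ctx (sig E) φ n)
                    (I : Index (sig E) φ) (a : Basic (sig E) φ) : Set where
    field
      ctx-shape : ∀ x → Shapeᵐ (lookup As x) (lookup Γ x)
      ty-shape  : Shape a σ
      ctx-ok    : ∀ x {ρ c} → f ∋ ρ ↦ c → ρ ⊩ᵐ lookup As x ∋ ctx D c x
      ty-ok     : ∀ {ρ c} → f ∋ ρ ↦ c → ρ ⊩ a ∋ ty D c
      wt-ok     : Denotes f I (wt D)

    ctx-self : E ∣ Φ ⊢ As ⊑ᶜ As
    ctx-self = ⊑ᶜ-family f {Γ = Γ} As As (ctx D) ctx-shape ctx-shape ctx-ok ctx-ok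

    ctx-⊑ : ∀ {Bs : Fin n → Modal (sig E) φ} → (∀ x → Shapeᵐ (Bs x) (lookup Γ x)) →
            (∀ x {ρ c} → f ∋ ρ ↦ c → ρ ⊩ᵐ Bs x ∋ ctx D c x) → E ∣ Φ ⊢ As ⊑ᶜ tabulate Bs
    ctx-⊑ {Bs} Bs-shape Bs-ok = ⊑ᶜ-family f {Γ = Γ} As (tabulate Bs) (ctx D)
      ctx-shape (lookup-tabulate (λ x B → Shapeᵐ B (lookup Γ x)) Bs-shape)
      ctx-ok    (lookup-tabulate (λ x B → ∀ {ρ c} → f ∋ ρ ↦ c → ρ ⊩ᵐ B ∋ ctx D c x) Bs-ok)

  open Represents

  represents : ∀ {Φ : Constraints (sig E) φ} {Γ : Vec PCFType n} {D : Derivations Γ σ}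
                 {f : Family Φ (Carrier D)} {As : Fin n → Modal (sig E) φ} {I a} →
               (∀ x → Shapeᵐ (As x) (lookup Γ x)) → Shape a σ →
               (∀ x {ρ c} → f ∋ ρ ↦ c → ρ ⊩ᵐ As x ∋ ctx D c x) →
               (∀ {ρ c} → f ∋ ρ ↦ c → ρ ⊩ a ∋ ty D c) → Denotes f I (wt D) →
               Represents D f (tabulate As) I a
  represents {Γ = Γ} {D} {f} As-shape a-shape As-ok a-ok I-ok = record
    { ctx-shape = lookup-tabulate (λ x B → Shapeᵐ B (lookup Γ x)) As-shape
    ; ty-shape  = a-shape
    ; ctx-ok    = lookup-tabulate (λ x B → ∀ {ρ c} → f ∋ ρ ↦ c → ρ ⊩ᵐ B ∋ ctx D c x) As-ok
    ; ty-ok     = a-ok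
    ; wt-ok     = I-ok
    }

  type-var : ∀ {Φ : Constraints (sig E) φ} {Γ : Vec PCFType n} x
               (f : Family Φ (Ty (lookup Γ x))) {As J b} →
             Represents ⟦ var {Γ = Γ} x ⟧ f As J b → E ∣ Φ ︔ As ⊢[ J ] var x ∶ b
  type-var {Φ = Φ} {Γ} x f {As} {J} {b} r = go (lookup As x) refl (ctx-shape r x) λ {ρ} {s′} at →
    subst (ρ ⊩ᵐ lookup As x ∋_) (once-same Γ x s′) (ctx-ok r x at)
    where
    go : ∀ B → lookup As x ≡ B → Shapeᵐ B (lookup Γ x) →
         (∀ {ρ s′} → f ∋ ρ ↦ s′ → ρ ⊩ᵐ B ∋ (s′ ∷ [])) → E ∣ Φ ︔ As ⊢[ J ] var x ∶ b
    go ([< I ]· a) eq (mod a-shape) ok =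
      V eq
        (≼-family f (λ _ → 0) (λ _ → 0) (λ _ → 𝟎-⇓) (wt-ok r) λ _ → z≤n)
        (≼-family f (λ _ → 1) (λ _ → 1) (λ _ → 𝟏-⇓) bound-ok λ _ → ≤-refl)
        -- The list of uses has one element, so its only entry is found by putting 𝟎 for the bound
        -- variable.
        (⊑-family f id (sub-Shape a-shape) (ty-shape r) head-ok (ty-ok r))
        (ctx-self r)
      where
      bound-ok : Denotes f I (λ _ → 1)
      bound-ok at with ok at
      ... | mod e _ = e
      head-ok : ∀ {ρ s′} → f ∋ ρ ↦ s′ → ρ ⊩ a [ 𝟎 ] ∋ s′
      head-ok {ρ} at with ok at
      ... | mod _ as = sub-⊩ values (as 0 refl)
        where
        values : Values (𝟎 • var) (0 ∷ ρ) ρ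
        values zero    = 𝟎-⇓
        values (suc i) = var i

  type : ∀ {Φ : Constraints (sig E) φ} {Γ : Vec PCFType n} {t} (d : Γ ⊢ t ∶ σ)
           (f : Family Φ (Carrier ⟦ d ⟧)) {As I a} →
         Represents ⟦ d ⟧ f As I a → E ∣ Φ ︔ As ⊢[ I ] t ∶ a
  type (var x) f r = type-var x f r
  type (lit k) f {a = Nat[ I ⋯ J ]} r =
    N (≼-family f (λ _ → 0) (λ _ → 0) (λ _ → 𝟎-⇓) (wt-ok r) λ _ → z≤n)
      (≼-family f (λ _ → k) (λ _ → k) (λ at → proj₁ (nat-instance⁻ (ty-ok r at))) (λ _ → num-⇓ k)
                λ _ → ≤-refl)
      (≼-family f (λ _ → k) (λ _ → k) (λ _ → num-⇓ k) (λ at → proj₂ (nat-instance⁻ (ty-ok r at)))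
                λ _ → ≤-refl)
      (ctx-self r)
  type (lit k) f {a = _ ⊸ _} r with ty-shape r
  ... | ()
  type (s d) f {a = _ ⊸ _} r with ty-shape r
  ... | ()
  type (s d) f {a = Nat[ K ⋯ H ]} r with represent f (value ∘ ty ⟦ d ⟧)
  ... | I , I-ok =
    S (type d f record
        { ctx-shape = ctx-shape r ; ty-shape = nat ; ctx-ok = ctx-ok r
        ; ty-ok = λ at → nat-instance _ (I-ok at) (I-ok at) ; wt-ok = wt-ok r })
      (⊑-family f (ty ⟦ s d ⟧) nat nat
        (λ at → nat-instance _ (suc-ok at) (suc-ok at)) (ty-ok r))
    where
    suc-ok : Denotes f (I +ᵢ 𝟏) (value ∘ mapNat suc ∘ ty ⟦ d ⟧)
    suc-ok {c = c} at with ty ⟦ d ⟧ c | I-ok at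
    ... | nat k | e = ⇓-≡ (+-comm k 1) (+-⇓ e 𝟏-⇓)
  type (p d) f {a = _ ⊸ _} r with ty-shape r
  ... | ()
  type (p d) f {a = Nat[ K ⋯ H ]} r with represent f (value ∘ ty ⟦ d ⟧)
  ... | I , I-ok =
    P (type d f record
        { ctx-shape = ctx-shape r ; ty-shape = nat ; ctx-ok = ctx-ok r
        ; ty-ok = λ at → nat-instance _ (I-ok at) (I-ok at) ; wt-ok = wt-ok r })
      (⊑-family f (ty ⟦ p d ⟧) nat nat
        (λ at → nat-instance _ (pred-ok at) (pred-ok at)) (ty-ok r))
    where
    pred-ok : Denotes f (I ∸ᵢ 𝟏) (value ∘ mapNat (_∸ 1) ∘ ty ⟦ d ⟧)
    pred-ok {c = c} at with ty ⟦ d ⟧ c | I-ok at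
    ... | nat k | e = ∸-⇓ e 𝟏-⇓
  type (ƛ d) f {a = Nat[ _ ⋯ _ ]} r with ty-shape r
  ... | ()
  type (ƛ d) f {a = B ⊸ b} r with ty-shape r
  ... | fun B-shape b-shape =
    L (type d f record
        { ctx-shape = λ { zero → B-shape ; (suc x) → ctx-shape r x }
        ; ty-shape  = b-shape
        ; ctx-ok    = λ { zero at → domain (ty-ok r at) ; (suc x) at → ctx-ok r x at }
        ; ty-ok     = λ at → codomain (ty-ok r at)
        ; wt-ok     = wt-ok r })
    where
    domain : ∀ {ρ l} {s′ : Ty τ} → ρ ⊩ B ⊸ b ∋ (l ↣ s′) → ρ ⊩ᵐ B ∋ l
    domain (fun h _) = h
    codomain : ∀ {ρ} {l : List (Ty σ)} {s′} → ρ ⊩ B ⊸ b ∋ (l ↣ s′) → ρ ⊩ b ∋ s′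
    codomain (fun _ h) = h
  type {φ = φ} {n = n} {Φ = Φ} {Γ = Γ} (_∙_ {σ = σ} d e) f {a = b} r =
    A {I = I} {Γ = tabulate Γ̂} {Δ = tabulate Δ̂} {Θ = tabulate Θ̂} {Ξ = tabulate Ξ̂}
      (type d (mapᶠ f proj₁) (represents
        (λ x → mod (whole-shape x)) (fun (mod arg-shape) (ty-shape r))
        (λ x at → mapᶠ-elim f proj₁ at λ at → proj₁ (split x at))
        (λ at → mapᶠ-elim f proj₁ at function-ty)
        (λ at → mapᶠ-elim f proj₁ at J-ok)))
      (type e g (represents
        (λ x → mod (sub-Shape (sub-Shape (whole-shape x)))) arg-shape
        (λ { x {i ∷ ρ} at → args-ctx x at })
        (λ { {i ∷ ρ} at → args-ty at })
        K-ok))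
      (lookup-tabulate₂ (∑[< I ]_≔_) λ x → bounded (lenΔ x) (later x))
      (lookup-tabulate₃ _⊎_≔_ λ x → join (lenΓ x) (∑ I (lenΔ x)) (whole x))
      (ctx-⊑ r (λ x → mod (whole-shape x)) λ x at → proj₂ (proj₂ (split x at)))
      (≼-family f weight weight
        (λ {_} {c} at → +-⇓ (+-⇓ (J-ok at) (I-ok at))
          (∑-⇓ (wt ⟦ e ⟧) (args c) (I-ok at) λ i eq → K-ok (select⁺ f args I I-ok at eq)))
        (wt-ok r) λ _ → ≤-refl)
    where
    weight = wt ⟦ d ∙ e ⟧

    args : Carrier ⟦ d ∙ e ⟧ → List (Carrier ⟦ e ⟧)
    args (_ , as , _) = as

    I-rep = represent f (length ∘ args)
    I = proj₁ I-rep

    I-ok : Denotes f I (length ∘ args)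
    I-ok = proj₂ I-rep

    g : Family (Φ ,< I) (Carrier ⟦ e ⟧)
    g = select f args I I-ok

    J-rep = represent f (wt ⟦ d ⟧ ∘ proj₁)
    J-ok : Denotes f (proj₁ J-rep) (wt ⟦ d ⟧ ∘ proj₁)
    J-ok = proj₂ J-rep

    K-rep = represent g (wt ⟦ e ⟧)
    K-ok : Denotes g (proj₁ K-rep) (wt ⟦ e ⟧)
    K-ok = proj₂ K-rep

    arg-rep = represent* f (dom ∘ ty ⟦ d ⟧ ∘ proj₁)
    arg-shape = proj₁ (proj₂ arg-rep)

    lenΓ-rep = λ x → represent f (λ c → length (ctx ⟦ d ⟧ (proj₁ c) x))
    lenΓ = λ x → proj₁ (lenΓ-rep x)

    lenΔ-rep = λ x → represent g (λ c → length (ctx ⟦ e ⟧ c x))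
    lenΔ = λ x → proj₁ (lenΔ-rep x)

    -- One body for all uses of `x`, in the function and in every copy of the argument. `Γ̂`, `Θ̂`
    -- and `Δ̂` are cut out of it so that `∑` and `⊎` hold by construction.
    whole-rep = λ x → represent* f (λ c → ctx ⟦ d ∙ e ⟧ c x)
    whole = λ x → proj₁ (whole-rep x)

    whole-shape : ∀ x → Shape (whole x) (lookup Γ x)
    whole-shape x = proj₁ (proj₂ (whole-rep x))

    later : Fin n → Basic (sig E) (suc φ)
    later x = subᵇ ((wk (lenΓ x) +ᵢ var zero) • (λ i → var (suc i))) (whole x)

    Γ̂ Θ̂ Ξ̂ : Fin n → Modal (sig E) φ
    Γ̂ x = [< lenΓ x ]· whole x
    Θ̂ x = [< ∑ I (lenΔ x) ]· later x
    Ξ̂ x = [< lenΓ x +ᵢ ∑ I (lenΔ x) ]· whole x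

    Δ̂ : Fin n → Modal (sig E) (suc φ)
    Δ̂ x = [< lenΔ x ]· subᵇ ((∑ (var (suc zero)) (under₂ (lenΔ x)) +ᵢ var zero)
                                • (λ i → var (suc (suc i)))) (later x)

    arg-lists : ∀ x → Carrier ⟦ d ∙ e ⟧ → List (List (Ty (lookup Γ x)))
    arg-lists x c = map (λ a → ctx ⟦ e ⟧ a x) (args c)

    module _ (x : Fin n) {ρ : Vec ℕ φ} {c : Carrier ⟦ d ∙ e ⟧} (at : f ∋ ρ ↦ c) where

      count : E ∣ ρ ⊢ I ⇓ length (arg-lists x c)
      count = ⇓-≡ (sym (length-map _ (args c))) (I-ok at)

      lengths : ∀ i {xs} → nth (arg-lists x c) i ≡ just xs →
                E ∣ i ∷ ρ ⊢ lenΔ x ⇓ length xs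
      lengths i eq with nth-map⁻ _ (args c) i eq
      ... | a , eq′ , refl = proj₂ (lenΔ-rep x) (select⁺ f args I I-ok at eq′)

      split : ρ ⊩ᵐ Γ̂ x ∋ ctx ⟦ d ⟧ (proj₁ c) x ×
              Entries ρ (later x) (concat (arg-lists x c)) ×
              ρ ⊩ᵐ Ξ̂ x ∋ ctx ⟦ d ∙ e ⟧ c x
      split = split-⊎ _ _ (proj₂ (lenΓ-rep x) at) (∑-concat-⇓ (arg-lists x c) count lengths)
                      (proj₂ (proj₂ (whole-rep x)) at)

    function-ty : ∀ {ρ c} → f ∋ ρ ↦ c → ρ ⊩ ([< I ]· proj₁ arg-rep) ⊸ b ∋ ty ⟦ d ⟧ (proj₁ c)
    function-ty {c = m , as , eq} at with ty ⟦ d ⟧ m | eq | proj₂ (proj₂ arg-rep) at | ty-ok r at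
    ... | l ↣ s′ | refl | as-ok | b-ok =
      fun (mod (⇓-≡ (sym (length-map _ as)) (I-ok at)) as-ok) b-ok

    args-ctx : ∀ x {i ρ a} → g ∋ i ∷ ρ ↦ a → (i ∷ ρ) ⊩ᵐ Δ̂ x ∋ ctx ⟦ e ⟧ a x
    args-ctx x {i} at with select⁻ f args I I-ok at
    ... | c , at′ , eq =
      split-∑ (arg-lists x c) (lengths x at′) (proj₁ (proj₂ (split x at′))) i (nth-map _ (args c) i eq)

    args-ty : ∀ {i ρ a} → g ∋ i ∷ ρ ↦ a → (i ∷ ρ) ⊩ proj₁ arg-rep ∋ ty ⟦ e ⟧ a
    args-ty {i} at with select⁻ f args I I-ok at
    ... | c@(m , as , tys) , at′ , eq =
      proj₂ (proj₂ arg-rep) at′ i (trans (cong (λ l → nth l i) (sym tys)) (nth-map _ as i eq))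
  type {φ = φ} {n = n} {Φ = Φ} {Γ = Γ} (ifz d then e₀ else e₁) f {a = b} r =
    -- The interval is the exact value of the scrutinee, so the constraints of the two branches
    -- exclude each other.
    F {I = I} {J = I} {Γ = tabulate Γ̂} {Δ = tabulate Δ̂} {Ξ = tabulate Ξ̂}
      (type d (mapᶠ f proj₁) (represents
        (λ x → mod (whole-shape x)) nat
        (λ x at → mapᶠ-elim f proj₁ at λ at → proj₁ (split x at))
        (λ at → mapᶠ-elim f proj₁ at λ at → nat-instance (ty ⟦ d ⟧ _) (I-ok at) (I-ok at))
        (λ at → mapᶠ-elim f proj₁ at K-ok)))
      (type e₀ f₀ (represents
        (λ x → mod (sub-Shape (whole-shape x))) (ty-shape r)
        (λ x at → branch-ctx-ok x (proj₂ (proj₂ (f₀⁻ at))))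
        (λ at → ty-ok r (proj₂ (proj₂ (f₀⁻ at))))
        (λ at → H-ok (proj₂ (proj₂ (f₀⁻ at))))))
      (type e₁ f₁ (represents
        (λ x → mod (sub-Shape (whole-shape x))) (ty-shape r)
        (λ x at → branch-ctx-ok x (proj₂ (proj₂ (f₁⁻ at))))
        (λ at → ty-ok r (proj₂ (proj₂ (f₁⁻ at))))
        (λ at → H-ok (proj₂ (proj₂ (f₁⁻ at))))))
      (⊑-family f (ty D) (ty-shape r) (ty-shape r) (ty-ok r) (ty-ok r))
      (lookup-tabulate₃ _⊎_≔_ λ x → join (lenΓ x) (lenΔ x) (whole x))
      (ctx-⊑ r (λ x → mod (whole-shape x)) λ x at → proj₂ (proj₂ (split x at)))
      (≼-family f (wt D) (wt D) (λ at → +-⇓ (K-ok at) (H-ok at)) (wt-ok r) λ _ → ≤-refl)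
    where
    D = ⟦ ifz d then e₀ else e₁ ⟧

    branch-ctx : Carrier D → Uses Γ
    branch-ctx (_ , a) x =
      [_,_]′ (λ (_ , a₀) → ctx ⟦ e₀ ⟧ a₀ x) (λ (_ , a₁) → ctx ⟦ e₁ ⟧ a₁ x) a

    branch-wt : Carrier D → ℕ
    branch-wt (_ , a) = [_,_]′ (wt ⟦ e₀ ⟧ ∘ proj₂) (wt ⟦ e₁ ⟧ ∘ proj₂) a

    scrutinee : Carrier D → ℕ
    scrutinee (m , _) = value (ty ⟦ d ⟧ m)

    I-rep = represent f scrutinee
    I = proj₁ I-rep

    I-ok : Denotes f I scrutinee
    I-ok = proj₂ I-rep

    K-rep = represent f (wt ⟦ d ⟧ ∘ proj₁)
    K-ok : Denotes f (proj₁ K-rep) (wt ⟦ d ⟧ ∘ proj₁)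
    K-ok = proj₂ K-rep

    -- Rule `F` has one weight and one context for both branches; they take the values of the branch
    -- that is executed.
    H-rep = represent f branch-wt
    H-ok : Denotes f (proj₁ H-rep) branch-wt
    H-ok = proj₂ H-rep

    select₀ : Carrier D → Maybe (Carrier ⟦ e₀ ⟧)
    select₀ (_ , inj₁ (_ , a)) = just a
    select₀ (_ , inj₂ _)       = nothing

    select₁ : Carrier D → Maybe (Carrier ⟦ e₁ ⟧)
    select₁ (_ , inj₁ _)       = nothing
    select₁ (_ , inj₂ (_ , a)) = just a

    total₀ : ∀ {ρ c} → f ∋ ρ ↦ c → True E ρ (I ≼ 𝟎) → ∃ λ a → select₀ c ≡ just a
    total₀ {c = _ , inj₁ (_ , a)}   at _ = a , refl
    total₀ {c = _ , inj₂ (1≤v , _)} at (_ , _ , e , e′ , v≤w)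
      with ⇓-functional e (I-ok at) | ⇓-functional e′ 𝟎-⇓
    ... | refl | refl = ⊥-elim (1+n≰n (≤-trans 1≤v v≤w))

    total₁ : ∀ {ρ c} → f ∋ ρ ↦ c → True E ρ (I ≽ 𝟏) → ∃ λ a → select₁ c ≡ just a
    total₁ {c = _ , inj₂ (_ , a)}   at _ = a , refl
    total₁ {c = _ , inj₁ (v≡0 , _)} at (_ , _ , e , e′ , v≤w)
      with ⇓-functional e 𝟏-⇓ | ⇓-functional e′ (I-ok at)
    ... | refl | refl = ⊥-elim (1+n≰n (≤-trans v≤w (≤-reflexive v≡0)))

    f₀ = refine f (I ≼ 𝟎) select₀ total₀
    f₁ = refine f (I ≽ 𝟏) select₁ total₁

    f₀⁻ : ∀ {ρ a} → f₀ ∋ ρ ↦ a → ∃₂ λ m v≡0 → f ∋ ρ ↦ (m , inj₁ (v≡0 , a))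
    f₀⁻ at with refine⁻ f (I ≼ 𝟎) select₀ total₀ at
    ... | (m , inj₁ (v≡0 , _)) , at′ , refl = m , v≡0 , at′

    f₁⁻ : ∀ {ρ a} → f₁ ∋ ρ ↦ a → ∃₂ λ m 1≤v → f ∋ ρ ↦ (m , inj₂ (1≤v , a))
    f₁⁻ at with refine⁻ f (I ≽ 𝟏) select₁ total₁ at
    ... | (m , inj₂ (1≤v , _)) , at′ , refl = m , 1≤v , at′

    lenΓ-rep = λ x → represent f (λ c → length (ctx ⟦ d ⟧ (proj₁ c) x))
    lenΓ = λ x → proj₁ (lenΓ-rep x)

    lenΔ-rep = λ x → represent f (λ c → length (branch-ctx c x))
    lenΔ = λ x → proj₁ (lenΔ-rep x)

    whole-rep = λ x → represent* f (λ c → ctx D c x)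
    whole = λ x → proj₁ (whole-rep x)

    whole-shape : ∀ x → Shape (whole x) (lookup Γ x)
    whole-shape x = proj₁ (proj₂ (whole-rep x))

    Γ̂ Δ̂ Ξ̂ : Fin n → Modal (sig E) φ
    Γ̂ x = [< lenΓ x ]· whole x
    Δ̂ x = [< lenΔ x ]· subᵇ ((wk (lenΓ x) +ᵢ var zero) • (λ i → var (suc i))) (whole x)
    Ξ̂ x = [< lenΓ x +ᵢ lenΔ x ]· whole x

    split : ∀ x {ρ c} → f ∋ ρ ↦ c →
            ρ ⊩ᵐ Γ̂ x ∋ ctx ⟦ d ⟧ (proj₁ c) x ×
            Entries ρ _ (branch-ctx c x) ×
            ρ ⊩ᵐ Ξ̂ x ∋ ctx D c x
    split x at = split-⊎ _ _ (proj₂ (lenΓ-rep x) at) (proj₂ (lenΔ-rep x) at)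
                         (proj₂ (proj₂ (whole-rep x)) at)

    branch-ctx-ok : ∀ x {ρ c} → f ∋ ρ ↦ c → ρ ⊩ᵐ Δ̂ x ∋ branch-ctx c x
    branch-ctx-ok x at = mod (proj₂ (lenΔ-rep x) at) (proj₁ (proj₂ (split x at)))
  type {φ = φ} {n = n} {Φ = Φ} {Γ = Γ} (fix {σ = σ} d) f {a = b} r =
    -- Both `L` and `M` are the number of nodes, the exact value of `△ 𝟎 𝟏 I`.
    R {I = I} {K = K} {L = Z} {M = Z} {σ = child} {τ = τ̂} {Γ = tabulate Γ̂} {Ξ = tabulate Ξ̂}
      (type d g (record
        { ctx-shape = λ { zero → mod child-shape
                        ; (suc x) → lookup-tabulate (λ x B → Shapeᵐ B (lookup Γ x))
                                      (λ x → mod (sub-Shape (whole-shape x))) x }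
        ; ty-shape  = τ̂-shape
        ; ctx-ok    = λ { zero at → mod (I-ok at) (child-ok at)
                        ; (suc x) at → lookup-tabulate
                            (λ x B → ∀ {ρ m} → g ∋ ρ ↦ m → ρ ⊩ᵐ B ∋ ctx ⟦ d ⟧ m (suc x))
                            (λ { x {i ∷ ρ} at → node-ctx x at }) x at }
        ; ty-ok     = τ̂-ok
        ; wt-ok     = K-ok
        }))
      (⊑-family f proj₁ (sub-Shape τ̂-shape) (ty-shape r) root-ty (ty-ok r))
      (⊑-family h id (sub-Shape τ̂-shape) child-shape
        (λ { {a ∷ i ∷ ρ} at → child-ty at }) (λ { {a ∷ i ∷ ρ} at → child-entry at }))
      (lookup-tabulate₂ (∑[< Z ]_≔_) λ x → bounded (lenΓ x) (whole x))
      (ctx-⊑ r (λ x → mod (whole-shape x)) λ x {_} {c} at →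
        mod (∑-concat-⇓ (ctx-lists x c) (count x at) (lengths x at)) (whole-ok x at))
      (≼-family f size′ size′ forest-size Z-ok λ _ → ≤-refl)
      (≼-family f size′ size′ forest-size Z-ok λ _ → ≤-refl)
      (≼-family f (wt ⟦ fix d ⟧) (wt ⟦ fix d ⟧)
        (λ {_} {c} at → +-⇓ (∸-⇓ (Z-ok at) 𝟏-⇓)
          (∑-⇓ (wt ⟦ d ⟧) (all c) (Z-ok at) λ i eq → K-ok (at-node at eq)))
        (wt-ok r) λ _ → ≤-refl)
    where
    all : Carrier ⟦ fix d ⟧ → List (Carrier ⟦ d ⟧)
    all (_ , T) = nodes T

    size′ : Carrier ⟦ fix d ⟧ → ℕ
    size′ = length ∘ all

    Z-rep = represent f size′
    Z = proj₁ Z-rep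

    Z-ok : Denotes f Z size′
    Z-ok = proj₂ Z-rep

    -- The variable `b` of rule `R` is the pre-order number of a node, and `I` its number of
    -- children.
    g : Family (Φ ,< Z) (Carrier ⟦ d ⟧)
    g = select f all Z Z-ok

    at-node : ∀ {ρ c i m} → f ∋ ρ ↦ c → nth (all c) i ≡ just m → g ∋ i ∷ ρ ↦ m
    at-node = select⁺ f all Z Z-ok

    I-rep = represent g (λ m → length (ctx ⟦ d ⟧ m zero))
    I = proj₁ I-rep

    I-ok : Denotes g I (λ m → length (ctx ⟦ d ⟧ m zero))
    I-ok = proj₂ I-rep

    h : Family ((Φ ,< Z) ,< I) (Ty σ)
    h = select g (λ m → ctx ⟦ d ⟧ m zero) I I-ok

    K-rep = represent g (wt ⟦ d ⟧)
    K = proj₁ K-rep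

    K-ok : Denotes g K (wt ⟦ d ⟧)
    K-ok = proj₂ K-rep

    τ̂-rep = representᵇ g (ty ⟦ d ⟧)
    τ̂ = proj₁ τ̂-rep
    τ̂-shape = proj₁ (proj₂ τ̂-rep)

    τ̂-ok : ∀ {ρ m} → g ∋ ρ ↦ m → ρ ⊩ τ̂ ∋ ty ⟦ d ⟧ m
    τ̂-ok = proj₂ (proj₂ τ̂-rep)

    child-rep = represent* g (λ m → ctx ⟦ d ⟧ m zero)
    child = proj₁ child-rep
    child-shape = proj₁ (proj₂ child-rep)

    child-ok : ∀ {ρ m} → g ∋ ρ ↦ m → Entries ρ child (ctx ⟦ d ⟧ m zero)
    child-ok = proj₂ (proj₂ child-rep)

    lenΓ-rep = λ x → represent g (λ m → length (ctx ⟦ d ⟧ m (suc x)))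
    lenΓ = λ x → proj₁ (lenΓ-rep x)

    whole-rep = λ x → represent* f (λ c → ctx ⟦ fix d ⟧ c x)
    whole = λ x → proj₁ (whole-rep x)

    whole-shape : ∀ x → Shape (whole x) (lookup Γ x)
    whole-shape x = proj₁ (proj₂ (whole-rep x))

    whole-ok : ∀ x {ρ c} → f ∋ ρ ↦ c → Entries ρ (whole x) (ctx ⟦ fix d ⟧ c x)
    whole-ok x = proj₂ (proj₂ (whole-rep x))

    Ξ̂ : Fin n → Modal (sig E) φ
    Ξ̂ x = [< ∑ Z (lenΓ x) ]· whole x

    Γ̂ : Fin n → Modal (sig E) (suc φ)
    Γ̂ x = [< lenΓ x ]· subᵇ ((∑ (var (suc zero)) (under₂ (lenΓ x)) +ᵢ var zero)
                                • (λ i → var (suc (suc i)))) (whole x)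

    ctx-lists : ∀ x → Carrier ⟦ fix d ⟧ → List (List (Ty (lookup Γ x)))
    ctx-lists x c = map (λ m → ctx ⟦ d ⟧ m (suc x)) (all c)

    count : ∀ x {ρ c} → f ∋ ρ ↦ c → E ∣ ρ ⊢ Z ⇓ length (ctx-lists x c)
    count x {c = c} at = ⇓-≡ (sym (length-map _ (all c))) (Z-ok at)

    lengths : ∀ x {ρ c} → f ∋ ρ ↦ c → ∀ i {xs} → nth (ctx-lists x c) i ≡ just xs →
              E ∣ i ∷ ρ ⊢ lenΓ x ⇓ length xs
    lengths x {c = c} at i eq with nth-map⁻ _ (all c) i eq
    ... | m , eq′ , refl = proj₂ (lenΓ-rep x) (at-node at eq′)

    node-ctx : ∀ x {i ρ m} → g ∋ i ∷ ρ ↦ m → (i ∷ ρ) ⊩ᵐ Γ̂ x ∋ ctx ⟦ d ⟧ m (suc x)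
    node-ctx x {i} at with select⁻ f all Z Z-ok at
    ... | c , at′ , eq =
      split-∑ (ctx-lists x c) (lengths x at′) (whole-ok x at′) i (nth-map _ (all c) i eq)

    root-ty : ∀ {ρ c} → f ∋ ρ ↦ c → ρ ⊩ τ̂ [ 𝟎 ] ∋ proj₁ c
    root-ty {ρ} {c = _ , T} at with root T
    ... | m , eq , refl = sub-⊩ values (τ̂-ok (at-node at eq))
      where
      values : Values (𝟎 • var) (0 ∷ ρ) ρ
      values zero    = 𝟎-⇓
      values (suc i) = var i

    forest-size : Denotes f (△ 𝟎 𝟏 I) size′
    forest-size {ρ} {_ , T} at = forest 𝟎-⇓ 𝟏-⇓
      -- The unfolding is a forest of one tree; its enumeration ends in an empty list that has to be
      -- removed.
      (subst (λ ms → Forest E ρ I 0 1 (length ms)) (++-identityʳ (nodes T))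
        (forest-of (nodes T) (λ i eq → I-ok (at-node at eq)) (T ∷ [])
          λ i eq → trans (cong (λ ms → nth ms i) (sym (++-identityʳ (nodes T)))) eq))

    child-entry : ∀ {a i ρ s′} → h ∋ a ∷ i ∷ ρ ↦ s′ → (a ∷ i ∷ ρ) ⊩ child ∋ s′
    child-entry {a} at with select⁻ g (λ m → ctx ⟦ d ⟧ m zero) I I-ok at
    ... | m , at′ , eq = child-ok at′ a eq

    child-ty : ∀ {a i ρ s′} → h ∋ a ∷ i ∷ ρ ↦ s′ →
               (a ∷ i ∷ ρ) ⊩ subᵇ ((△ (var (suc zero) +ᵢ 𝟏) (var zero) (under₂ I)
                                       +ᵢ var (suc zero) +ᵢ 𝟏)
                                     • (λ j → var (suc (suc j)))) τ̂ ∋ s′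
    child-ty {a} {i} {ρ} at with select⁻ g (λ m → ctx ⟦ d ⟧ m zero) I I-ok at
    ... | m , at′ , eq with select⁻ f all Z Z-ok at′
    ... | (_ , T) , at″ , eq′ with children T i eq′
    ... | Us , located
      -- The forest starts at `i + 1` with no tree accumulated. The resulting `k` counts the nodes
      -- of the first `a` subtrees of node `i`, so its child number `a` is node `k + i + 1`.
      with child-from (nodes T)
             (λ j eq″ → ren-⇓ (lift-Agree j λ _ → refl) (I-ok (at-node at″ eq″)))
             Us (λ j eq″ → trans (cong (λ o → nth (nodes T) (o + j)) (+-identityʳ (i + 1)))
                                 (located j eq″))
             zero eq
    ... | k , m′ , fs , eq″ , refl =
      sub-⊩ values (τ̂-ok (at-node at″ (trans (cong (nth (nodes T)) (regroup k i)) eq″)))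
      where
      regroup : ∀ k i → k + i + 1 ≡ i + 1 + k
      regroup = solve-∀
      values : Values _ ((k + i + 1) ∷ ρ) (a ∷ i ∷ ρ)
      values zero    = +-⇓ (+-⇓ (forest (+-⇓ (var (suc zero)) 𝟏-⇓) (var zero) fs) (var (suc zero))) 𝟏-⇓
      values (suc j) = var (suc (suc j))

theorem5p6 : (U : Program) → Universal U →
    (t : Term 0) → [] ⊢ t ∶ Nat →
    (n m : ℕ) → t ⇓[ n ] m →
    ∃₂ λ (I J : Index (sig U) 0) →
    (∃ λ k → (U ∣ [] ⊢ I ⇓ k) × k ≤ n) ×
    (U ∣ [] ⊢ J ⇓ m) ×
    (U ∣ [] ︔ [] ⊢[ I ] t ∶ Nat[ J ])
theorem5p6 U universal t d n m (_ , _ , run) with expand d [] [] run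
... | _ , _ , _ , clo c eq [] , [] , weight≤n =
  -- Closed index terms have a single value, so numerals suffice at the root.
  num (wt ⟦ d ⟧ c) , num m ,
  -- The empty environment and the empty stack each contribute 0 to the bounded weight.
  (_ , num-⇓ (wt ⟦ d ⟧ c) , ≤-trans (≤-trans (m≤m+n _ 0) (m≤m+n _ 0)) weight≤n) ,
  num-⇓ m ,
  type d run-family (represents {As = λ ()} (λ ()) nat (λ ()) ty-ok′ λ { (_ , refl) → num-⇓ (wt ⟦ d ⟧ c) })
  where
  open Evaluation U
  open Instances U
  open Conversion U (Universal.determined universal)
  open Completeness U (Universal.determined universal)

  -- Without index variables the empty assignment is the only model, so the derivation obtained from
  -- the run is the whole family.
  run-family : Family {φ = 0} [] (Carrier ⟦ d ⟧)
  run-family = record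
    { at      = λ _ → just c
    ; defined = λ _ → c , refl
    ; bound   = 0
    ; bounds  = λ { {[]} _ → Vec.[] }
    }

  ty-ok′ : ∀ {ρ c′} → run-family ∋ ρ ↦ c′ → ρ ⊩ Nat[ num m ⋯ num m ] ∋ ty ⟦ d ⟧ c′
  ty-ok′ (_ , refl) = subst (_ ⊩ _ ∋_) (sym eq) (nat (num-⇓ m) (num-⇓ m))
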